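{- Let $p$ be a prime number, let $\mathcal{K}$ be a family of number fields stable by taking subfields, and let $\{\mathcal{X}_k\}_{k\in\mathcal{K}}$ be a family of finite invariants of $p$-power order with norms and transfers, as described in the context. Let $L/K$, with $K,L\in\mathcal{K}$, be a cyclic $p$-extension of degree $p^N$; for $n\in[0,N]$ let $K_n$ be the subfield of $L$ of degree $p^n$ over $K$ and put $\mathcal{X}_n:=\mathcal{X}_{K_n}$. Assume that, for all $n\in[0,N-1]$, the arithmetic norms $\mathcal{X}_{n+1}\to\mathcal{X}_n$ are surjective and the transfer maps $\mathcal{X}_n\to\mathcal{X}_{n+1}$ are injective. Let $p^{e_n}$ be the exponent of $\mathcal{X}_n$. Then $$\#\mathcal{X}_{n+h}\ \ge\ \#\mathcal{X}_n\cdot\#\mathcal{X}_n[p^h]\ \ge\ \#\mathcal{X}_n\cdot p^{\min(e_n,h)}$$ for all $n\in[0,N]$ and all $h\in[0,N-n]$, where $\mathcal{X}_n[p^h]:=\{x\in\mathcal{X}_n:\ x^{p^h}=1\}$.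
   Context: The family $\{\mathcal{X}_k\}_{k\in\mathcal{K}}$ consists of finite invariants (groups written multiplicatively) of $p$-power order, indexed by $\mathcal{K}$, fulfilling the following conditions for $k,k'\in\mathcal{K}$ with $k\subseteq k'$: (i) for any Galois extension $k'/k$, of Galois group $G$, $\mathcal{X}_{k'}$ is a $\mathbb{Z}_p[G]$-module; (ii) there exist norms $\mathbf{N}_{k'/k}:\mathcal{X}_{k'}\to\mathcal{X}_k$ (called arithmetic norms) and transfers $\mathbf{J}_{k'/k}:\mathcal{X}_k\to\mathcal{X}_{k'}$ such that $\mathbf{J}_{k'/k}\circ\mathbf{N}_{k'/k}=\nu_{k'/k}$, where $\nu_{k'/k}$ is the algebraic norm, i.e. the sum $\sum_{\tau\in G}\tau$ of the elements of $G=\mathrm{Gal}(k'/k)$; (iii) if $G=\mathrm{Gal}(k'/k)$ is a cyclic $p$-group, one defines the associated filtration $\{\mathcal{X}_{k'}^i\}_{i\ge 0}$ by $\mathcal{X}_{k'}^0=1$ and $\mathcal{X}_{k'}^{i+1}/\mathcal{X}_{k'}^i:=(\mathcal{X}_{k'}/\mathcal{X}_{k'}^i)^G$ for all $i\ge 0$. -}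

module Defs where

open import Level using (Level; _⊔_; 0ℓ) renaming (suc to lsuc)
open import Algebra.Bundles
open import Algebra.Module.Structures using (IsLeftModule)
open import Algebra.Morphism.Structures
  using (IsRingIsomorphism; IsGroupHomomorphism)
import Algebra.Morphism.Construct.Composition as Compose
import Algebra.Morphism.Construct.Identity as Identity
import Algebra.Properties.Group as GroupProperties
import Algebra.Properties.Monoid.Mult as Mult
import Algebra.Properties.CommutativeMonoid.Sum as CMSum
import Algebra.Properties.Semiring.Sum as SemiringSum
open import Data.Fin.Base using (Fin; zero; suc)
import Data.Fin.Permutation as Perm
import Data.Fin.Properties as Fin
open import Data.Integer.Base as ℤ using (ℤ; +_; -[1+_])
import Data.Integer.Properties as ℤ
open import Data.Integer.Divisibility.Signed using (_∣_; divides; ∣m∣n⇒∣m+n; ∣m⇒∣-m; ∣n⇒∣m*n)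
open import Data.Integer.Tactic.RingSolver using (solve-∀)
open import Data.Nat.Base as ℕ using (ℕ)
open import Data.Product.Base using (Σ; ∃; _×_; _,_; proj₁; proj₂)
open import Data.Rational.Base using (ℚ; ↥_; ↧ₙ_)
open import Function.Base using (_∘_; _on_; id)
open import Function.Bundles using (Func; Inverse)
open import Function.Definitions using (Injective; Surjective)
open import Relation.Binary.Bundles using (Setoid)
open import Relation.Binary.Definitions using (_Respects_) renaming (Decidable to Decidable₂)
import Relation.Binary.Construct.On as On
import Relation.Binary.Reasoning.Setoid as ≈-Reasoning
open import Relation.Binary.PropositionalEquality as ≡ using (_≡_)
open import Relation.Nullary.Decidable as Dec using (Dec; yes; no; map′)
open import Relation.Nullary.Negation using (¬_; contradiction)
open import Relation.Unary using (Pred; Decidable; _∈_; _⊆_)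

record Finite {a ℓ} (S : Setoid a ℓ) : Set (a ⊔ ℓ) where
  field
    card        : ℕ
    enumeration : Inverse (≡.setoid (Fin card)) S

  open Setoid S
  open Inverse enumeration public using ()
    renaming (to to element; from to index; from-cong to index-cong)

  element-index : ∀ x → element (index x) ≈ x
  element-index x = Inverse.strictlyInverseˡ enumeration x

  index-element : ∀ i → index (element i) ≡ i
  index-element i = Inverse.strictlyInverseʳ enumeration i

  _≟_ : Decidable₂ _≈_
  x ≟ y = map′
    (λ eq → trans (sym (element-index x))
              (trans (reflexive (≡.cong element eq)) (element-index y)))
    index-cong
    (index x Fin.≟ index y)

subsetoid : ∀ {a ℓ q} (S : Setoid a ℓ) → Pred (Setoid.Carrier S) q → Setoid (a ⊔ q) ℓ
subsetoid S P = On.setoid {B = Σ (Setoid.Carrier S) P} S proj₁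

private
  finite-Fin-subset : ∀ {q} n (P : Pred (Fin n) q) → Decidable P →
                      Finite (subsetoid (≡.setoid (Fin n)) P)
  finite-Fin-subset ℕ.zero P P? = record
    { card        = 0
    ; enumeration = mkInverse′
    }
    where
    mkInverse′ : Inverse (≡.setoid (Fin 0)) (subsetoid (≡.setoid (Fin 0)) P)
    mkInverse′ = record
      { to        = λ ()
      ; from      = λ { (() , _) }
      ; to-cong   = λ { {()} }
      ; from-cong = λ { {() , _} }
      ; inverse   = (λ { {() , _} }) , (λ { {()} })
      }
  finite-Fin-subset (ℕ.suc n) P P? = go (P? zero)
    where
    S = subsetoid (≡.setoid (Fin (ℕ.suc n))) P
    F = finite-Fin-subset n (P ∘ suc) (P? ∘ suc)
    module F = Finite F

    up : Σ (Fin n) (P ∘ suc) → Σ (Fin (ℕ.suc n)) P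
    up (i , pi) = suc i , pi

    go : Dec (P zero) → Finite S
    go (yes p₀) = record
      { card        = ℕ.suc F.card
      ; enumeration = record
        { to        = to
        ; from      = from
        ; to-cong   = λ { ≡.refl → ≡.refl }
        ; from-cong = λ { {zero , _}  {zero , _}  _  → ≡.refl
                        ; {suc i , _} {suc j , _} eq → ≡.cong suc (F.index-cong (Fin.suc-injective eq)) }
        ; inverse   = (λ { {x} ≡.refl → to-from x })
                    , (λ { {i} {x} eq → ≡.trans (from-cong x (to i) eq) (from-to i) })
        }
      }
      where
      to : Fin (ℕ.suc F.card) → Σ (Fin (ℕ.suc n)) P
      to zero    = zero , p₀
      to (suc i) = up (F.element i)
      from : Σ (Fin (ℕ.suc n)) P → Fin (ℕ.suc F.card)
      from (zero  , _)  = zero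
      from (suc i , pi) = suc (F.index (i , pi))
      from-cong : ∀ x y → proj₁ x ≡ proj₁ y → from x ≡ from y
      from-cong (zero , _)  (zero , _)  _  = ≡.refl
      from-cong (suc i , _) (suc j , _) eq = ≡.cong suc (F.index-cong (Fin.suc-injective eq))
      to-from : ∀ x → proj₁ (to (from x)) ≡ proj₁ x
      to-from (zero  , _)  = ≡.refl
      to-from (suc i , pi) = ≡.cong suc (F.element-index (i , pi))
      from-to : ∀ i → from (to i) ≡ i
      from-to zero    = ≡.refl
      from-to (suc i) = ≡.cong suc (F.index-element i)
    go (no ¬p₀) = record
      { card        = F.card
      ; enumeration = record
        { to        = up ∘ F.element
        ; from      = from
        ; to-cong   = λ { ≡.refl → ≡.refl }
        ; from-cong = λ {x} {y} → from-cong x y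
        ; inverse   = (λ { {x} ≡.refl → to-from x })
                    , (λ { {i} {x} eq → ≡.trans (from-cong x (up (F.element i)) eq) (F.index-element i) })
        }
      }
      where
      from : Σ (Fin (ℕ.suc n)) P → Fin F.card
      from (zero  , p₀) = contradiction p₀ ¬p₀
      from (suc i , pi) = F.index (i , pi)
      from-cong : ∀ x y → proj₁ x ≡ proj₁ y → from x ≡ from y
      from-cong (zero , p₀) _           _  = contradiction p₀ ¬p₀
      from-cong (suc i , _) (suc j , _) eq = F.index-cong (Fin.suc-injective eq)
      to-from : ∀ x → proj₁ (up (F.element (from x))) ≡ proj₁ x
      to-from (zero  , p₀) = contradiction p₀ ¬p₀
      to-from (suc i , pi) = ≡.cong suc (F.element-index (i , pi))

finite-subset : ∀ {a ℓ q} {S : Setoid a ℓ} (P : Pred (Setoid.Carrier S) q) →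
                P Respects Setoid._≈_ S → Decidable P →
                Finite S → Finite (subsetoid S P)
finite-subset {S = S} P resp P? fin = record
  { card        = G.card
  ; enumeration = record
    { to        = to
    ; from      = from
    ; to-cong   = λ { ≡.refl → refl }
    ; from-cong = λ {x} {y} → from-cong x y
    ; inverse   = (λ { {x} ≡.refl → to-from x })
                , (λ { {i} {x} eq → ≡.trans (from-cong x (to i) eq) (from-to i) })
    }
  }
  where
  open Setoid S
  module F = Finite fin
  module G = Finite (finite-Fin-subset F.card (P ∘ F.element) (P? ∘ F.element))
  to : Fin G.card → Σ Carrier P
  to i = F.element (proj₁ (G.element i)) , proj₂ (G.element i)
  from : Σ Carrier P → Fin G.card
  from (x , px) = G.index (F.index x , resp (sym (F.element-index x)) px)
  from-cong : ∀ x y → proj₁ x ≈ proj₁ y → from x ≡ from y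
  from-cong x y eq = G.index-cong (F.index-cong eq)
  to-from : ∀ x → proj₁ (to (from x)) ≈ proj₁ x
  to-from (x , px) = trans (reflexive (≡.cong F.element (G.element-index _))) (F.element-index x)
  from-to : ∀ i → from (to i) ≡ i
  from-to i = ≡.trans (G.index-cong (F.index-element _)) (G.index-element i)

module Powers {c ℓ} (G : Group c ℓ) where
  open Group G
  open Mult monoid using () renaming (_×_ to _times_; ×-congʳ to times-congʳ)

  infixr 8 _^_ _^ᶻ_

  _^_ : Carrier → ℕ → Carrier
  x ^ n = n times x

  _^ᶻ_ : Carrier → ℤ → Carrier
  x ^ᶻ (+ n)    = x ^ n
  x ^ᶻ -[1+ n ] = (x ^ ℕ.suc n) ⁻¹

  ^-congˡ : ∀ n {x y} → x ≈ y → x ^ n ≈ y ^ n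
  ^-congˡ n = times-congʳ n

  IsCyclic : Set (c ⊔ ℓ)
  IsCyclic = ∃ λ σ → ∀ τ → ∃ λ (z : ℤ) → τ ≈ σ ^ᶻ z

  Torsion : ℕ → Pred Carrier ℓ
  Torsion m x = x ^ m ≈ ε

  torsion-finite : Finite setoid → ∀ m → Finite (subsetoid setoid (Torsion m))
  torsion-finite fin m = finite-subset (Torsion m)
    (λ {x} {y} x≈y xᵐ≈ε → trans (sym (^-congˡ m x≈y)) xᵐ≈ε)
    (λ x → Finite._≟_ fin (x ^ m) ε)
    fin

  record IsExponent (m : ℕ) : Set (c ⊔ ℓ) where
    field
      positive    : m ℕ.> 0
      annihilates : ∀ x → x ^ m ≈ ε
      least       : ∀ {m′} → m′ ℕ.> 0 → (∀ x → x ^ m′ ≈ ε) → m ℕ.≤ m′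

-- The group ring R[G] of a finite group: functions G → R with convolution.

module GroupRing {r ℓr g ℓg} (R : CommutativeRing r ℓr) (G : Group g ℓg)
                 (finite : Finite (Group.setoid G)) where

  private
    module R = CommutativeRing R
    module G where
      open Group G public
      open GroupProperties G public
    module F = Finite finite
  open CMSum R.+-commutativeMonoid using (sum; sum-cong-≋; ∑-comm; ∑-distrib-+; sum-permute; sum-replicate-zero)
  open SemiringSum R.semiring using (*-distribˡ-sum; *-distribʳ-sum)
  open ≈-Reasoning R.setoid

  Element : Set (r ⊔ ℓr ⊔ g ⊔ ℓg)
  Element = Func G.setoid R.setoid

  open Func using (cong) renaming (to to coeff)

  infix 4 _≈_
  _≈_ : Element → Element → Set (ℓr ⊔ g)
  a ≈ b = ∀ x → coeff a x R.≈ coeff b x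

  ∑-cong : ∀ {φ ψ : Fin F.card → R.Carrier} → (∀ i → φ i R.≈ ψ i) → sum φ R.≈ sum ψ
  ∑-cong = sum-cong-≋

  ∑G : (G.Carrier → R.Carrier) → R.Carrier
  ∑G φ = sum (φ ∘ F.element)

  _+_ : Element → Element → Element
  a + b = record
    { to   = λ x → coeff a x R.+ coeff b x
    ; cong = λ eq → R.+-cong (cong a eq) (cong b eq)
    }

  -_ : Element → Element
  - a = record { to = λ x → R.- coeff a x ; cong = λ eq → R.-‿cong (cong a eq) }

  0# : Element
  0# = record { to = λ _ → R.0# ; cong = λ _ → R.refl }

  _*_ : Element → Element → Element
  a * b = record
    { to   = λ x → ∑G λ y → coeff a y R.* coeff b (y G.⁻¹ G.∙ x)
    ; cong = λ eq → ∑-cong λ i → R.*-congˡ (cong b (G.∙-congˡ eq))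
    }

  indicator : ∀ {q} {Q : Set q} → Dec Q → R.Carrier
  indicator (yes _) = R.1#
  indicator (no _)  = R.0#

  indicator-cong : ∀ {p q} {P : Set p} {Q : Set q} (P? : Dec P) (Q? : Dec Q) →
                   (P → Q) → (Q → P) → indicator P? R.≈ indicator Q?
  indicator-cong (yes _) (yes _) _ _ = R.refl
  indicator-cong (no _)  (no _)  _ _ = R.refl
  indicator-cong (yes p) (no ¬q) f _ = contradiction (f p) ¬q
  indicator-cong (no ¬p) (yes q) _ f = contradiction (f q) ¬p

  δ : G.Carrier → Element
  δ g = record
    { to   = λ x → indicator (x F.≟ g)
    ; cong = λ {x} {y} eq → indicator-cong (x F.≟ g) (y F.≟ g)
                              (G.trans (G.sym eq)) (G.trans eq)
    }

  ∑-indicator : ∀ {n} (k : Fin n) (φ : Fin n → R.Carrier) →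
                sum (λ i → indicator (i Fin.≟ k) R.* φ i) R.≈ φ k
  ∑-indicator {ℕ.suc n} zero φ = begin
    R.1# R.* φ zero R.+ sum (λ i → R.0# R.* φ (suc i))
      ≈⟨ R.+-cong (R.*-identityˡ _) (sum-cong-≋ (λ i → R.zeroˡ (φ (suc i)))) ⟩
    φ zero R.+ sum {n} (λ _ → R.0#)  ≈⟨ R.+-congˡ (sum-replicate-zero n) ⟩
    φ zero R.+ R.0#                  ≈⟨ R.+-identityʳ _ ⟩
    φ zero                           ∎
  ∑-indicator {ℕ.suc n} (suc k) φ = begin
    R.0# R.* φ zero R.+ sum (λ i → indicator (suc i Fin.≟ suc k) R.* φ (suc i))
      ≈⟨ R.+-cong (R.zeroˡ _) (sum-cong-≋ (λ i → R.*-congʳ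
           (indicator-cong (suc i Fin.≟ suc k) (i Fin.≟ k) Fin.suc-injective (≡.cong suc)))) ⟩
    R.0# R.+ sum (λ i → indicator (i Fin.≟ k) R.* φ (suc i))
      ≈⟨ R.+-identityˡ _ ⟩
    sum (λ i → indicator (i Fin.≟ k) R.* φ (suc i))
      ≈⟨ ∑-indicator k (φ ∘ suc) ⟩
    φ (suc k) ∎

  ∑G-δ : ∀ g (φ : Element) → ∑G (λ y → coeff (δ g) y R.* coeff φ y) R.≈ coeff φ g
  ∑G-δ g φ = begin
    ∑G (λ y → coeff (δ g) y R.* coeff φ y)
      ≈⟨ ∑-cong (λ i → R.*-congʳ (indicator-cong (F.element i F.≟ g) (i Fin.≟ F.index g)
           (λ eq → ≡.trans (≡.sym (F.index-element i)) (F.index-cong eq))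
           (λ eq → G.trans (G.reflexive (≡.cong F.element eq)) (F.element-index g)))) ⟩
    sum (λ i → indicator (i Fin.≟ F.index g) R.* coeff φ (F.element i))
      ≈⟨ ∑-indicator (F.index g) (coeff φ ∘ F.element) ⟩
    coeff φ (F.element (F.index g))
      ≈⟨ cong φ (F.element-index g) ⟩
    coeff φ g ∎

  ∑G-translate : ∀ g (φ : Element) → ∑G (coeff φ) R.≈ ∑G (λ y → coeff φ (g G.∙ y))
  ∑G-translate g φ = begin
    ∑G (coeff φ)
      ≈⟨ sum-permute (coeff φ ∘ F.element) π ⟩
    sum (λ i → coeff φ (F.element (F.index (g G.∙ F.element i))))
      ≈⟨ ∑-cong (λ i → cong φ (F.element-index _)) ⟩
    ∑G (λ y → coeff φ (g G.∙ y)) ∎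
    where
    shift : G.Carrier → Fin F.card → Fin F.card
    shift h i = F.index (h G.∙ F.element i)
    undo : ∀ h k → (∀ x → h G.∙ (k G.∙ x) G.≈ x) → ∀ i → shift h (shift k i) ≡ i
    undo h k hk i = ≡.trans
      (F.index-cong (G.trans (G.∙-congˡ (F.element-index _)) (hk _)))
      (F.index-element i)
    π : Perm.Permutation F.card F.card
    π = Perm.permutation (shift g) (shift (g G.⁻¹))
      (undo g (g G.⁻¹) (G.\\-leftDividesˡ g))
      (undo (g G.⁻¹) g (G.\\-leftDividesʳ g))

  *-cong : ∀ {a b c d} → a ≈ b → c ≈ d → a * c ≈ b * d
  *-cong ab cd x = ∑-cong λ i → R.*-cong (ab _) (cd _)

  *-assoc : ∀ a b c → (a * b) * c ≈ a * (b * c)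
  *-assoc a b c x = begin
    sum (λ i → sum (λ j → coeff a (y j) R.* coeff b (y j G.⁻¹ G.∙ y i)) R.* coeff c (y i G.⁻¹ G.∙ x))
      ≈⟨ ∑-cong (λ i → *-distribʳ-sum (coeff c (y i G.⁻¹ G.∙ x))
           (λ j → coeff a (y j) R.* coeff b (y j G.⁻¹ G.∙ y i))) ⟩
    sum (λ i → sum (λ j → (coeff a (y j) R.* coeff b (y j G.⁻¹ G.∙ y i)) R.* coeff c (y i G.⁻¹ G.∙ x)))
      ≈⟨ ∑-cong (λ i → ∑-cong (λ j → R.*-assoc _ _ _)) ⟩
    sum (λ i → sum (λ j → coeff a (y j) R.* (coeff b (y j G.⁻¹ G.∙ y i) R.* coeff c (y i G.⁻¹ G.∙ x))))
      ≈⟨ ∑-comm (λ i j → coeff a (y j) R.* (coeff b (y j G.⁻¹ G.∙ y i) R.* coeff c (y i G.⁻¹ G.∙ x))) ⟩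
    sum (λ j → sum (λ i → coeff a (y j) R.* (coeff b (y j G.⁻¹ G.∙ y i) R.* coeff c (y i G.⁻¹ G.∙ x))))
      ≈⟨ ∑-cong (λ j → *-distribˡ-sum (coeff a (y j))
           (λ i → coeff b (y j G.⁻¹ G.∙ y i) R.* coeff c (y i G.⁻¹ G.∙ x))) ⟨
    sum (λ j → coeff a (y j) R.* sum (λ i → coeff b (y j G.⁻¹ G.∙ y i) R.* coeff c (y i G.⁻¹ G.∙ x)))
      ≈⟨ ∑-cong (λ j → R.*-congˡ (reindex (y j))) ⟩
    sum (λ j → coeff a (y j) R.* sum (λ i → coeff b (y i) R.* coeff c (y i G.⁻¹ G.∙ (y j G.⁻¹ G.∙ x)))) ∎
    where
    y = F.element
    term : G.Carrier → Element
    term h = record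
      { to   = λ z → coeff b (h G.⁻¹ G.∙ z) R.* coeff c (z G.⁻¹ G.∙ x)
      ; cong = λ eq → R.*-cong (cong b (G.∙-congˡ eq)) (cong c (G.∙-congʳ (G.⁻¹-cong eq)))
      }
    reindex : ∀ h → ∑G (λ z → coeff b (h G.⁻¹ G.∙ z) R.* coeff c (z G.⁻¹ G.∙ x))
                    R.≈ ∑G (λ z → coeff b z R.* coeff c (z G.⁻¹ G.∙ (h G.⁻¹ G.∙ x)))
    reindex h = R.trans (∑G-translate h (term h)) (∑-cong λ i → R.*-cong
      (cong b (G.\\-leftDividesʳ h _))
      (cong c (G.trans (G.∙-congʳ (G.⁻¹-anti-homo-∙ h _)) (G.assoc _ _ _))))

  *-identityˡ : ∀ a → δ G.ε * a ≈ a
  *-identityˡ a x = R.trans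
    (∑G-δ G.ε record
      { to   = λ y → coeff a (y G.⁻¹ G.∙ x)
      ; cong = λ eq → cong a (G.∙-congʳ (G.⁻¹-cong eq)) })
    (cong a (G.trans (G.∙-congʳ G.ε⁻¹≈ε) (G.identityˡ x)))

  *-identityʳ : ∀ a → a * δ G.ε ≈ a
  *-identityʳ a x = begin
    ∑G (λ y → coeff a y R.* coeff (δ G.ε) (y G.⁻¹ G.∙ x))
      ≈⟨ ∑-cong (λ i → R.*-congˡ (indicator-cong
           ((F.element i G.⁻¹ G.∙ x) F.≟ G.ε) (F.element i F.≟ x)
           (λ eq → G.sym (G.trans (G.trans (G.sym (G.\\-leftDividesˡ (F.element i) x))
                                           (G.∙-congˡ eq)) (G.identityʳ _)))
           (λ eq → G.trans (G.∙-congˡ (G.sym eq)) (G.inverseˡ _)))) ⟩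
    ∑G (λ y → coeff a y R.* coeff (δ x) y)
      ≈⟨ ∑-cong (λ i → R.*-comm _ _) ⟩
    ∑G (λ y → coeff (δ x) y R.* coeff a y)
      ≈⟨ ∑G-δ x a ⟩
    coeff a x ∎

  distribˡ : ∀ a b c → a * (b + c) ≈ (a * b) + (a * c)
  distribˡ a b c x = R.trans (∑-cong λ i → R.distribˡ (coeff a (F.element i)) _ _)
    (∑-distrib-+ (λ i → coeff a (F.element i) R.* coeff b (F.element i G.⁻¹ G.∙ x))
                 (λ i → coeff a (F.element i) R.* coeff c (F.element i G.⁻¹ G.∙ x)))

  distribʳ : ∀ a b c → (b + c) * a ≈ (b * a) + (c * a)
  distribʳ a b c x = R.trans (∑-cong λ i → R.distribʳ _ _ _)
    (∑-distrib-+ (λ i → coeff b (F.element i) R.* coeff a (F.element i G.⁻¹ G.∙ x))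
                 (λ i → coeff c (F.element i) R.* coeff a (F.element i G.⁻¹ G.∙ x)))

  groupRing : Ring (r ⊔ ℓr ⊔ g ⊔ ℓg) (ℓr ⊔ g)
  groupRing = record
    { Carrier = Element
    ; _≈_     = _≈_
    ; _+_     = _+_
    ; _*_     = _*_
    ; -_      = -_
    ; 0#      = 0#
    ; 1#      = δ G.ε
    ; isRing  = record
      { +-isAbelianGroup = record
        { isGroup = record
          { isMonoid = record
            { isSemigroup = record
              { isMagma = record
                { isEquivalence = record
                  { refl  = λ _ → R.refl
                  ; sym   = λ eq x → R.sym (eq x)
                  ; trans = λ eq eq′ x → R.trans (eq x) (eq′ x)
                  }
                ; ∙-cong = λ eq eq′ x → R.+-cong (eq x) (eq′ x)
                }
              ; assoc = λ _ _ _ _ → R.+-assoc _ _ _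
              }
            ; identity = (λ _ _ → R.+-identityˡ _) , (λ _ _ → R.+-identityʳ _)
            }
          ; inverse = (λ _ _ → R.-‿inverseˡ _) , (λ _ _ → R.-‿inverseʳ _)
          ; ⁻¹-cong = λ eq x → R.-‿cong (eq x)
          }
        ; comm = λ _ _ _ → R.+-comm _ _
        }
      ; *-cong     = λ {a} {b} {c} {d} → *-cong {a} {b} {c} {d}
      ; *-assoc    = *-assoc
      ; *-identity = *-identityˡ , *-identityʳ
      ; distrib    = distribˡ , distribʳ
      }
    }

  ν : Element
  ν = CMSum.sum (Ring.+-commutativeMonoid groupRing) (δ ∘ F.element)

-- The ring of p-adic integers, as the inverse limit of the ℤ/pⁿ: sequences
-- (aₙ) of integers with aₙ₊₁ ≡ aₙ mod pⁿ, where (aₙ) and (bₙ) are identified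
-- when aₙ ≡ bₙ mod pⁿ for all n.

module PAdic (p : ℕ) where

  infix 4 _≡_[mod_]
  _≡_[mod_] : ℤ → ℤ → ℕ → Set
  a ≡ b [mod m ] = + m ∣ a ℤ.- b

  private
    ≡⇒≡mod : ∀ {m a b} → a ≡ b → a ≡ b [mod m ]
    ≡⇒≡mod {m} {a} ≡.refl = divides (+ 0) (ℤ.+-inverseʳ a)

    ≡mod-sym : ∀ {m a b} → a ≡ b [mod m ] → b ≡ a [mod m ]
    ≡mod-sym {m} {a} {b} h = ≡.subst (+ m ∣_) (lemma a b) (∣m⇒∣-m h)
      where
      lemma : ∀ a b → ℤ.- (a ℤ.- b) ≡ b ℤ.- a
      lemma = solve-∀

    ≡mod-trans : ∀ {m a b c} → a ≡ b [mod m ] → b ≡ c [mod m ] → a ≡ c [mod m ]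
    ≡mod-trans {m} {a} {b} {c} h k = ≡.subst (+ m ∣_) (lemma a b c) (∣m∣n⇒∣m+n h k)
      where
      lemma : ∀ a b c → (a ℤ.- b) ℤ.+ (b ℤ.- c) ≡ a ℤ.- c
      lemma = solve-∀

    ≡mod-+ : ∀ {m a b c d} → a ≡ b [mod m ] → c ≡ d [mod m ] → a ℤ.+ c ≡ b ℤ.+ d [mod m ]
    ≡mod-+ {m} {a} {b} {c} {d} h k = ≡.subst (+ m ∣_) (lemma a b c d) (∣m∣n⇒∣m+n h k)
      where
      lemma : ∀ a b c d → (a ℤ.- b) ℤ.+ (c ℤ.- d) ≡ (a ℤ.+ c) ℤ.- (b ℤ.+ d)
      lemma = solve-∀

    ≡mod-* : ∀ {m a b c d} → a ≡ b [mod m ] → c ≡ d [mod m ] → a ℤ.* c ≡ b ℤ.* d [mod m ]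
    ≡mod-* {m} {a} {b} {c} {d} h k =
      ≡.subst (+ m ∣_) (lemma a b c d) (∣m∣n⇒∣m+n (∣n⇒∣m*n c h) (∣n⇒∣m*n b k))
      where
      lemma : ∀ a b c d → c ℤ.* (a ℤ.- b) ℤ.+ b ℤ.* (c ℤ.- d) ≡ (a ℤ.* c) ℤ.- (b ℤ.* d)
      lemma = solve-∀

    ≡mod-neg : ∀ {m a b} → a ≡ b [mod m ] → ℤ.- a ≡ ℤ.- b [mod m ]
    ≡mod-neg {m} {a} {b} h = ≡.subst (+ m ∣_) (lemma a b) (∣m⇒∣-m h)
      where
      lemma : ∀ a b → ℤ.- (a ℤ.- b) ≡ (ℤ.- a) ℤ.- (ℤ.- b)
      lemma = solve-∀

  record ℤₚ : Set where
    field
      residue  : ℕ → ℤ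
      coherent : ∀ n → residue (ℕ.suc n) ≡ residue n [mod p ℕ.^ n ]
  open ℤₚ

  private
    constant : ℤ → ℤₚ
    constant z = record { residue = λ _ → z ; coherent = λ _ → ≡⇒≡mod {a = z} ≡.refl }

    _+_ _*_ : ℤₚ → ℤₚ → ℤₚ
    a + b = record
      { residue  = λ n → residue a n ℤ.+ residue b n
      ; coherent = λ n → ≡mod-+ {a = residue a (ℕ.suc n)} {residue a n} (coherent a n) (coherent b n)
      }
    a * b = record
      { residue  = λ n → residue a n ℤ.* residue b n
      ; coherent = λ n → ≡mod-* {a = residue a (ℕ.suc n)} {residue a n} (coherent a n) (coherent b n)
      }

    -_ : ℤₚ → ℤₚ
    - a = record
      { residue  = λ n → ℤ.- residue a n
      ; coherent = λ n → ≡mod-neg {a = residue a (ℕ.suc n)} {residue a n} (coherent a n)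
      }

    _≈_ : ℤₚ → ℤₚ → Set
    a ≈ b = ∀ n → residue a n ≡ residue b n [mod p ℕ.^ n ]

  ring : CommutativeRing 0ℓ 0ℓ
  ring = record
    { Carrier = ℤₚ
    ; _≈_     = _≈_
    ; _+_     = _+_
    ; _*_     = _*_
    ; -_      = -_
    ; 0#      = constant (+ 0)
    ; 1#      = constant (+ 1)
    ; isCommutativeRing = record
      { isRing = record
        { +-isAbelianGroup = record
          { isGroup = record
            { isMonoid = record
              { isSemigroup = record
                { isMagma = record
                  { isEquivalence = record
                    { refl  = λ {a} n → ≡⇒≡mod {a = residue a n} ≡.refl
                    ; sym   = λ {a} {b} eq n → ≡mod-sym {a = residue a n} (eq n)
                    ; trans = λ {a} {b} {c} eq eq′ n → ≡mod-trans {a = residue a n} {residue b n} (eq n) (eq′ n)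
                    }
                  ; ∙-cong = λ {a} {b} eq eq′ n → ≡mod-+ {a = residue a n} {residue b n} (eq n) (eq′ n)
                  }
                ; assoc = λ a b c n → ≡⇒≡mod (ℤ.+-assoc (residue a n) (residue b n) (residue c n))
                }
              ; identity = (λ a n → ≡⇒≡mod (ℤ.+-identityˡ (residue a n)))
                         , (λ a n → ≡⇒≡mod (ℤ.+-identityʳ (residue a n)))
              }
            ; inverse = (λ a n → ≡⇒≡mod (ℤ.+-inverseˡ (residue a n)))
                      , (λ a n → ≡⇒≡mod (ℤ.+-inverseʳ (residue a n)))
            ; ⁻¹-cong = λ {a} {b} eq n → ≡mod-neg {a = residue a n} {residue b n} (eq n)
            }
          ; comm = λ a b n → ≡⇒≡mod (ℤ.+-comm (residue a n) (residue b n))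
          }
        ; *-cong     = λ {a} {b} eq eq′ n → ≡mod-* {a = residue a n} {residue b n} (eq n) (eq′ n)
        ; *-assoc    = λ a b c n → ≡⇒≡mod (ℤ.*-assoc (residue a n) (residue b n) (residue c n))
        ; *-identity = (λ a n → ≡⇒≡mod (ℤ.*-identityˡ (residue a n)))
                     , (λ a n → ≡⇒≡mod (ℤ.*-identityʳ (residue a n)))
        ; distrib    = (λ a b c n → ≡⇒≡mod (ℤ.*-distribˡ-+ (residue a n) (residue b n) (residue c n)))
                     , (λ a b c n → ≡⇒≡mod (ℤ.*-distribʳ-+ (residue a n) (residue b n) (residue c n)))
        }
      ; *-comm = λ a b n → ≡⇒≡mod (ℤ.*-comm (residue a n) (residue b n))
      }
    }

record Field c ℓ : Set (lsuc (c ⊔ ℓ)) where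
  field
    commutativeRing : CommutativeRing c ℓ
  open CommutativeRing commutativeRing public
  field
    1≉0        : ¬ 1# ≈ 0#
    invertible : ∀ x → ¬ x ≈ 0# → ∃ λ y → x * y ≈ 1#

CharacteristicZero : ∀ {c ℓ} → Field c ℓ → Set ℓ
CharacteristicZero Ω = ∀ n → ¬ (ℕ.suc n times 1#) ≈ 0#
  where
  open Field Ω
  open Mult +-monoid using () renaming (_×_ to _times_)

-- Number fields live in a common overfield Ω (such as ℂ), which gives a meaning
-- to the inclusions between them.

module NumberFields {c ℓ} (Ω : Field c ℓ) (s : Level) where

  open Field Ω
  open CMSum +-commutativeMonoid using (sum)

  record Subfield : Set (c ⊔ ℓ ⊔ lsuc s) where
    field
      member      : Pred Carrier s
      resp        : member Respects _≈_
      0∈          : 0# ∈ member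
      1∈          : 1# ∈ member
      +-closed    : ∀ {x y} → x ∈ member → y ∈ member → x + y ∈ member
      *-closed    : ∀ {x y} → x ∈ member → y ∈ member → x * y ∈ member
      -‿closed    : ∀ {x} → x ∈ member → - x ∈ member
      inv-closed  : ∀ {x y} → x ∈ member → x * y ≈ 1# → y ∈ member

    asRing : CommutativeRing (c ⊔ s) ℓ
    asRing = record
      { Carrier = Σ Carrier member
      ; _≈_     = _≈_ on proj₁
      ; _+_     = λ (x , x∈) (y , y∈) → x + y , +-closed x∈ y∈
      ; _*_     = λ (x , x∈) (y , y∈) → x * y , *-closed x∈ y∈
      ; -_      = λ (x , x∈) → - x , -‿closed x∈
      ; 0#      = 0# , 0∈
      ; 1#      = 1# , 1∈
      ; isCommutativeRing = record
        { isRing = record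
          { +-isAbelianGroup = record
            { isGroup = record
              { isMonoid = record
                { isSemigroup = record
                  { isMagma = record
                    { isEquivalence = On.isEquivalence proj₁ isEquivalence
                    ; ∙-cong        = +-cong
                    }
                  ; assoc = λ _ _ _ → +-assoc _ _ _
                  }
                ; identity = (λ _ → +-identityˡ _) , (λ _ → +-identityʳ _)
                }
              ; inverse = (λ _ → -‿inverseˡ _) , (λ _ → -‿inverseʳ _)
              ; ⁻¹-cong = -‿cong
              }
            ; comm = λ _ _ → +-comm _ _
            }
          ; *-cong     = *-cong
          ; *-assoc    = λ _ _ _ → *-assoc _ _ _
          ; *-identity = (λ _ → *-identityˡ _) , (λ _ → *-identityʳ _)
          ; distrib    = (λ _ _ _ → distribˡ _ _ _) , (λ _ _ _ → distribʳ _ _ _)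
          }
        ; *-comm = λ _ _ → *-comm _ _
        }
      }

  -- V and F are subsets of Ω, F being (the set of elements of) a subfield.
  record Basis {f v} (F : Pred Carrier f) (V : Pred Carrier v) (d : ℕ) : Set (c ⊔ ℓ ⊔ f ⊔ v) where
    field
      vector      : Fin d → Carrier
      vector∈     : ∀ i → vector i ∈ V
      spanning    : ∀ {x} → x ∈ V → ∃ λ (a : Fin d → Carrier) →
                    (∀ i → a i ∈ F) × x ≈ sum (λ i → a i * vector i)
      independent : ∀ (a : Fin d → Carrier) → (∀ i → a i ∈ F) →
                    sum (λ i → a i * vector i) ≈ 0# → ∀ i → a i ≈ 0#

  -- The copy of ℚ inside Ω: x represents the fraction a/d when d x = a · 1
  -- (in the additive group of Ω, _^_ and _^ᶻ_ are integer multiples).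
  IsRational : Pred Carrier ℓ
  IsRational x = ∃ λ (q : ℚ) → x ^ (↧ₙ q) ≈ 1# ^ᶻ (↥ q)
    where open Powers +-group

  record NumberField : Set (c ⊔ ℓ ⊔ lsuc s) where
    field
      subfield : Subfield
      degree   : ℕ
      basis    : Basis IsRational (Subfield.member subfield) degree
    open Subfield subfield public

  infix 4 _⊑_
  _⊑_ : NumberField → NumberField → Set (c ⊔ s)
  k ⊑ k′ = NumberField.member k ⊆ NumberField.member k′

  HasDegree : NumberField → NumberField → ℕ → Set (c ⊔ ℓ ⊔ s)
  HasDegree k k′ d = Basis (NumberField.member k) (NumberField.member k′) d

  record Automorphism (k k′ : NumberField) : Set (c ⊔ ℓ ⊔ s) where
    private
      module k  = NumberField k
      module k′ = CommutativeRing (NumberField.asRing k′)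
    field
      map               : k′.Carrier → k′.Carrier
      isRingIsomorphism : IsRingIsomorphism k′.rawRing k′.rawRing map
      fixes             : ∀ x → proj₁ x ∈ k.member → map x k′.≈ x
    open IsRingIsomorphism isRingIsomorphism public

  Gal : NumberField → NumberField → Group (c ⊔ ℓ ⊔ s) (c ⊔ ℓ ⊔ s)
  Gal k k′ = record
    { Carrier = Automorphism k k′
    ; _≈_     = λ σ τ → ∀ x → map σ x k′.≈ map τ x
    ; _∙_     = _∘ᴬ_
    ; ε       = idᴬ
    ; _⁻¹     = invᴬ
    ; isGroup = record
      { isMonoid = record
        { isSemigroup = record
          { isMagma = record
            { isEquivalence = record
              { refl  = λ _ → refl
              ; sym   = λ eq x → sym (eq x)
              ; trans = λ eq eq′ x → trans (eq x) (eq′ x)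
              }
            ; ∙-cong = λ {σ} {σ′} {τ} {τ′} eq eq′ x →
                trans (eq (map τ x)) (map-cong σ′ _ _ (eq′ x))
            }
          ; assoc = λ _ _ _ _ → refl
          }
        ; identity = (λ _ _ → refl) , (λ _ _ → refl)
        }
      ; inverse = (λ σ x → map-injective σ _ _ (map-inv σ (map σ x)))
                , (λ σ x → map-inv σ x)
      ; ⁻¹-cong = λ {σ} {τ} eq x → map-injective σ _ _
          (trans (map-inv σ x) (trans (sym (map-inv τ x)) (sym (eq (inv τ x)))))
      }
    }
    where
    module k  = NumberField k
    module k′ = CommutativeRing (NumberField.asRing k′)
    open Automorphism using (map; isRingIsomorphism; fixes)

    map-cong : ∀ σ x y → x k′.≈ y → map σ x k′.≈ map σ y
    map-cong σ x y = Automorphism.⟦⟧-cong σ {x} {y}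

    map-injective : ∀ σ x y → map σ x k′.≈ map σ y → x k′.≈ y
    map-injective σ x y = Automorphism.injective σ {x} {y}

    inv : Automorphism k k′ → k′.Carrier → k′.Carrier
    inv σ y = proj₁ (Automorphism.surjective σ y)

    map-inv : ∀ σ y → map σ (inv σ y) k′.≈ y
    map-inv σ y = proj₂ (Automorphism.surjective σ y) {inv σ y} refl

    idᴬ : Automorphism k k′
    idᴬ = record
      { map               = id
      ; isRingIsomorphism = Identity.isRingIsomorphism k′.rawRing refl
      ; fixes             = λ _ _ → refl
      }

    _∘ᴬ_ : Automorphism k k′ → Automorphism k k′ → Automorphism k k′
    σ ∘ᴬ τ = record
      { map               = map σ ∘ map τ
      ; isRingIsomorphism = Compose.isRingIsomorphism {R₃ = k′.rawRing} trans
                              (isRingIsomorphism τ) (isRingIsomorphism σ)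
      ; fixes             = λ x x∈ → trans (map-cong σ _ _ (fixes τ x x∈)) (fixes σ x x∈)
      }

    invᴬ : Automorphism k k′ → Automorphism k k′
    invᴬ σ = record
      { map               = inv σ
      ; isRingIsomorphism = record
        { isRingMonomorphism = record
          { isRingHomomorphism = record
            { isSemiringHomomorphism = record
              { isNearSemiringHomomorphism = record
                { +-isMonoidHomomorphism = record
                  { isMagmaHomomorphism = record
                    { isRelHomomorphism = record
                      { cong = λ {x} {y} → inv-cong x y }
                    ; homo = λ x y → map-injective σ _ _ (trans (map-inv σ (x k′.+ y))
                        (sym (trans (σ.+-homo (inv σ x) (inv σ y)) (+-cong (map-inv σ x) (map-inv σ y)))))
                    }
                  ; ε-homo = map-injective σ _ _ (trans (map-inv σ k′.0#) (sym σ.0#-homo))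
                  }
                ; *-homo = λ x y → map-injective σ _ _ (trans (map-inv σ (x k′.* y))
                    (sym (trans (σ.*-homo (inv σ x) (inv σ y)) (*-cong (map-inv σ x) (map-inv σ y)))))
                }
              ; 1#-homo = map-injective σ _ _ (trans (map-inv σ k′.1#) (sym σ.1#-homo))
              }
            ; -‿homo = λ x → map-injective σ _ _ (trans (map-inv σ (k′.- x))
                (sym (trans (σ.-‿homo (inv σ x)) (-‿cong (map-inv σ x)))))
            }
          ; injective = λ {x} {y} eq → trans (sym (map-inv σ x))
              (trans (map-cong σ (inv σ x) (inv σ y) eq) (map-inv σ y))
          }
        ; surjective = λ y → map σ y , λ {z} eq →
            trans (inv-cong z (map σ y) eq) (map-injective σ _ y (map-inv σ (map σ y)))
        }
      ; fixes = λ x x∈ → map-injective σ _ _ (trans (map-inv σ x) (sym (fixes σ x x∈)))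
      }
      where
      module σ = Automorphism σ
      inv-cong : ∀ x y → x k′.≈ y → inv σ x k′.≈ inv σ y
      inv-cong x y eq = map-injective σ _ _ (trans (map-inv σ x) (trans eq (sym (map-inv σ y))))

  -- A finite extension is Galois when it has as many automorphisms as its degree.
  record Galois (k k′ : NumberField) : Set (c ⊔ ℓ ⊔ s) where
    field
      k⊑k′      : k ⊑ k′
      [k′:k]    : ℕ
      hasDegree : HasDegree k k′ [k′:k]
      finite    : Finite (Group.setoid (Gal k k′))
      ∣Gal∣     : Finite.card finite ≡ [k′:k]

  record CyclicExtension (k k′ : NumberField) (d : ℕ) : Set (c ⊔ ℓ ⊔ s) where
    field
      galois : Galois k k′
      cyclic : Powers.IsCyclic (Gal k k′)
      degree : Galois.[k′:k] galois ≡ d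

  record Intermediate (K L : NumberField) (d : ℕ) (k : NumberField) : Set (c ⊔ ℓ ⊔ s) where
    field
      K⊑k       : K ⊑ k
      k⊑L       : k ⊑ L
      hasDegree : HasDegree K k d

  StableUnderSubfields : ∀ {t} → Pred NumberField t → Set (c ⊔ ℓ ⊔ lsuc s ⊔ t)
  StableUnderSubfields 𝒦 = ∀ {k k′} → k ⊑ k′ → k′ ∈ 𝒦 → k ∈ 𝒦

  module _ (p : ℕ) {k k′ : NumberField} (G : Galois k k′) where

    private module ℤₚ[G] = GroupRing (PAdic.ring p) (Gal k k′) (Galois.finite G)

    ℤₚ[Gal] : Ring (c ⊔ ℓ ⊔ s) (c ⊔ ℓ ⊔ s)
    ℤₚ[Gal] = ℤₚ[G].groupRing

    algebraicNorm : Ring.Carrier ℤₚ[Gal]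
    algebraicNorm = ℤₚ[G].ν

  -- Proofs of membership in 𝒦 and of inclusion are irrelevant arguments, so that
  -- 𝒳, 𝐍 and 𝐉 depend on the fields only.
  record InvariantFamily {t} (p : ℕ) (𝒦 : Pred NumberField t) (x ξ : Level) :
                         Set (c ⊔ ℓ ⊔ lsuc (s ⊔ x ⊔ ξ) ⊔ t) where
    private module X (A : AbelianGroup x ξ) = AbelianGroup A
    field
      𝒳       : ∀ k → .(k ∈ 𝒦) → AbelianGroup x ξ
      finite  : ∀ k .(k∈ : k ∈ 𝒦) → Finite (X.setoid (𝒳 k k∈))
      p-power : ∀ k .(k∈ : k ∈ 𝒦) → ∃ λ a → Finite.card (finite k k∈) ≡ p ℕ.^ a

      action : ∀ {k k′} .(k∈ : k ∈ 𝒦) .(k′∈ : k′ ∈ 𝒦) (G : Galois k k′) →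
               Ring.Carrier (ℤₚ[Gal] p G) → X.Carrier (𝒳 k′ k′∈) → X.Carrier (𝒳 k′ k′∈)
      isModule : ∀ {k k′} .(k∈ : k ∈ 𝒦) .(k′∈ : k′ ∈ 𝒦) (G : Galois k k′) →
                 let module 𝒳′ = X (𝒳 k′ k′∈) in
                 IsLeftModule (ℤₚ[Gal] p G) 𝒳′._≈_ 𝒳′._∙_ 𝒳′.ε 𝒳′._⁻¹ (action k∈ k′∈ G)

      𝐍 : ∀ {k k′} .(k∈ : k ∈ 𝒦) .(k′∈ : k′ ∈ 𝒦) .(k⊑k′ : k ⊑ k′) →
          X.Carrier (𝒳 k′ k′∈) → X.Carrier (𝒳 k k∈)
      𝐉 : ∀ {k k′} .(k∈ : k ∈ 𝒦) .(k′∈ : k′ ∈ 𝒦) .(k⊑k′ : k ⊑ k′) →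
          X.Carrier (𝒳 k k∈) → X.Carrier (𝒳 k′ k′∈)
      𝐍-isHomomorphism : ∀ {k k′} .(k∈ : k ∈ 𝒦) .(k′∈ : k′ ∈ 𝒦) .(k⊑k′ : k ⊑ k′) →
        IsGroupHomomorphism (X.rawGroup (𝒳 k′ k′∈)) (X.rawGroup (𝒳 k k∈)) (𝐍 k∈ k′∈ k⊑k′)
      𝐉-isHomomorphism : ∀ {k k′} .(k∈ : k ∈ 𝒦) .(k′∈ : k′ ∈ 𝒦) .(k⊑k′ : k ⊑ k′) →
        IsGroupHomomorphism (X.rawGroup (𝒳 k k∈)) (X.rawGroup (𝒳 k′ k′∈)) (𝐉 k∈ k′∈ k⊑k′)

      𝐉∘𝐍 : ∀ {k k′} .(k∈ : k ∈ 𝒦) .(k′∈ : k′ ∈ 𝒦) (G : Galois k k′) →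
            let module 𝒳′ = X (𝒳 k′ k′∈); k⊑k′ = Galois.k⊑k′ G in
            ∀ z → 𝐉 k∈ k′∈ k⊑k′ (𝐍 k∈ k′∈ k⊑k′ z) 𝒳′.≈ action k∈ k′∈ G (algebraicNorm p G) z

    module _ k .(k∈ : k ∈ 𝒦) where
      private module P = Powers (X.group (𝒳 k k∈))

      #𝒳 : ℕ
      #𝒳 = Finite.card (finite k k∈)

      #𝒳-torsion : ℕ → ℕ
      #𝒳-torsion m = Finite.card (P.torsion-finite (finite k k∈) m)

      HasExponent : ℕ → Set (x ⊔ ξ)
      HasExponent = P.IsExponent

    module _ {k k′} .(k∈ : k ∈ 𝒦) .(k′∈ : k′ ∈ 𝒦) .(k⊑k′ : k ⊑ k′) where
      private
        module Xk  = X (𝒳 k k∈)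
        module Xk′ = X (𝒳 k′ k′∈)

      NormSurjective : Set (x ⊔ ξ)
      NormSurjective = Surjective Xk′._≈_ Xk._≈_ (𝐍 k∈ k′∈ k⊑k′)

      TransferInjective : Set (x ⊔ ξ)
      TransferInjective = Injective Xk._≈_ Xk′._≈_ (𝐉 k∈ k′∈ k⊑k′)

{-# OPTIONS --safe #-}

-- For a Galois step k′/k of degree p, an element J y of 𝒳ₖ′ is J (N z) = ν z for some z, and ν² = p ν, so
-- J (N (J y)) = (J y)ᵖ; as J is injective, N (J y) = yᵖ. Composing h such steps gives a surjective norm N and
-- an injective transfer J between 𝒳ₙ and 𝒳ₙ₊ₕ with N ∘ J = (_)^(pʰ), whence (x , t) ↦ s(x) J(t), for s a
-- section of N, embeds 𝒳ₙ × 𝒳ₙ[pʰ] into 𝒳ₙ₊ₕ. The torsion contains the powers of an element of order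
-- p^min(eₙ,h).
--
-- That Kₙ₊₁/Kₙ is Galois of degree p is Galois theory for a generator σ of Gal(L/K): equality in a number
-- field is decidable, so independence of characters and Artin's lemma can be proved with explicit witnesses.
-- They give Kₙ = Fix(σ^(pⁿ)), a basis of p elements of Kₙ₊₁ over Kₙ, and Gal(Kₙ₊₁/Kₙ) = { σ^(i pⁿ) : i < p }.

module Submission where

open import Defs
open import Level using (Level; _⊔_)
open import Algebra.Bundles using (AbelianGroup; CommutativeRing; Group; Monoid; Ring)
open import Algebra.Module.Structures using (IsLeftModule)
import Algebra.Morphism.Construct.Composition as Compose
import Algebra.Morphism.Construct.Identity as Identity
open import Algebra.Morphism.Structures using (IsGroupHomomorphism; IsMonoidHomomorphism; IsRingHomomorphism)
import Algebra.Properties.CommutativeMonoid.Sum as CMSum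
import Algebra.Properties.CommutativeSemigroup as CommutativeSemigroupProperties
import Algebra.Properties.Group as GroupProperties
import Algebra.Properties.Monoid.Mult as Mult
import Algebra.Properties.Monoid.Sum as MonoidSum
import Algebra.Properties.Ring as RingProperties
import Algebra.Properties.Semiring.Mult as SemiringMult
import Algebra.Properties.Semiring.Sum as SemiringSum
open import Data.Fin.Base using (Fin; zero; suc; combine; fromℕ<; punchIn; remQuot; toℕ)
import Data.Fin.Properties as Fin
open import Data.Integer.Base using (ℤ; +_; -[1+_])
open import Data.Nat.Base as ℕ using (ℕ; NonZero; >-nonZero; >-nonZero⁻¹; nonTrivial⇒n>1; s<s)
open import Data.Nat.Coprimality using (Coprime; coprime-divisor)
open import Data.Nat.Divisibility using (_∣_; _∣?_; divides; ∣1⇒≡1; ∣⇒≤; *-cancelˡ-∣)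
open import Data.Nat.DivMod using (_/_; _%_; m≡m%n+[m/n]*n; m%n<n)
open import Data.Nat.GCD using (module Bézout; module GCD)
open import Data.Nat.Primality using (Prime; prime⇒irreducible; prime⇒nonTrivial; prime⇒nonZero)
import Data.Nat.Properties as ℕ
open import Data.Product.Base using (∃; ∃₂; _×_; _,_; proj₁; proj₂)
open import Data.Rational.Base using (ℚ; ↥_; ↧ₙ_)
open import Data.Sum.Base using (inj₁; inj₂; [_,_]′)
open import Data.Vec.Functional using (_∷_; removeAt)
open import Function.Base using (_∘_; id)
open import Function.Bundles using (module Func)
import Function.Construct.Composition as FunctionCompose
open import Function.Definitions using (Injective; Surjective)
open import Relation.Binary.Definitions using (Decidable)
open import Relation.Binary.PropositionalEquality as ≡ using (_≡_; _≢_)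
import Relation.Binary.Reasoning.Setoid as ≈-Reasoning
open import Relation.Nullary using (Dec; yes; no; ¬_; ¬?; _×-dec_; contradiction; decidable-stable)
open import Relation.Nullary.Decidable using (map′)
open import Relation.Unary using (Pred; _∈_)

-- The relation 𝐉 ∘ 𝐍 = ν is available only for a `Galois` record, that is, an inclusion, a basis
-- and an enumeration of the automorphisms whose number is the degree. The layers come with no more
-- than their degree over K and their place between K and L, so even Kₙ ⊑ Kₙ₊₁ has to be derived.
-- The way in is a count: the restrictions to Kₙ of more than pⁿ powers of σ cannot all differ, so
-- the elements of Kₙ have a period below p^(n+1) under σ; as p^N is a period too, so is the gcd, a
-- power of p, and hence pⁿ. The converse inclusion is again a count, since Artin's lemma leaves no
-- room for more than pⁿ independent vectors in Fix(σ^(pⁿ)). Nothing in the conditions on the family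
-- relates 𝐍 and 𝐉 of Kₙ₊ₕ/Kₙ to those of the single steps. The maps between distant layers are
-- therefore composites of one-step maps, and the induction carries only the data of `NormTransfer`,
-- in which ν no longer occurs.

private variable c ℓ c′ ℓ′ : Level

-- Divisors of prime powers and periods of an element

divisor-of-prime-power : ∀ {p} → Prime p → ∀ N {d} → d ∣ p ℕ.^ N → ∃ λ t → d ≡ p ℕ.^ t
divisor-of-prime-power p-prime ℕ.zero d∣1 = 0 , ∣1⇒≡1 d∣1
divisor-of-prime-power {p} p-prime (ℕ.suc N) {d} d∣ with p ∣? d
... | yes (divides e ≡.refl) = ℕ.suc t , ≡.trans (ℕ.*-comm e p) (≡.cong (p ℕ.*_) e≡)
  where
  instance _ = prime⇒nonZero p-prime
  e∣ : ∃ λ t → e ≡ p ℕ.^ t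
  e∣ = divisor-of-prime-power p-prime N (*-cancelˡ-∣ p (≡.subst (_∣ p ℕ.^ ℕ.suc N) (ℕ.*-comm e p) d∣))
  t = proj₁ e∣
  e≡ = proj₂ e∣
... | no p∤d = divisor-of-prime-power p-prime N (coprime-divisor coprime d∣)
  where
  coprime : Coprime d p
  coprime (i∣d , i∣p) with prime⇒irreducible p-prime i∣p
  ... | inj₁ i≡1    = i≡1
  ... | inj₂ ≡.refl = contradiction i∣d p∤d

-- The exponents that fix one element, for θⁿ x ≈ x and yⁿ ≈ ε alike. Bézout's identity over ℕ has
-- the form d + y n = x m, so closure under cancellation takes the place of subtraction.
module Periods (T : ℕ → Set c) (zeroᵀ : T 0) (+ᵀ : ∀ m n → T m → T n → T (m ℕ.+ n))
               (cancelᵀ : ∀ m n → T (m ℕ.+ n) → T n → T m) where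

  multiple : ∀ {m} x → T m → T (x ℕ.* m)
  multiple ℕ.zero    _  = zeroᵀ
  multiple (ℕ.suc x) tm = +ᵀ _ _ tm (multiple x tm)

  period-∣ : ∀ {m n} → m ∣ n → T m → T n
  period-∣ (divides x ≡.refl) = multiple x

  period-gcd : ∀ {m n d} → Bézout.Identity d m n → T m → T n → T d
  period-gcd {m} {n} (Bézout.+- x y eq) tm tn = cancelᵀ _ _ (≡.subst T (≡.sym eq) (multiple x tm)) (multiple y tn)
  period-gcd {m} {n} (Bézout.-+ x y eq) tm tn = cancelᵀ _ _ (≡.subst T (≡.sym eq) (multiple y tn)) (multiple x tm)

  -- The gcd of d and p^N is again a period; it is a power of p and at most d, hence p^t with t ≤ m.
  prime-power-period : ∀ {p} → Prime p → ∀ N m {d} → 0 ℕ.< d → d ℕ.< p ℕ.^ ℕ.suc m →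
                       T d → T (p ℕ.^ N) → T (p ℕ.^ m)
  prime-power-period {p} p-prime N m {d} 0<d d<p^m+1 td tpᴺ with Bézout.lemma d (p ℕ.^ N)
  ... | Bézout.result g isGCD identity with divisor-of-prime-power p-prime N (GCD.gcd∣n isGCD)
  ... | t , ≡.refl = period-∣ (^-monoʳ-∣ t≤m) (period-gcd identity td tpᴺ)
    where
    instance _ = >-nonZero 0<d
    t≤m : t ℕ.≤ m
    t≤m = ℕ.≮⇒≥ λ m<t → ℕ.<-irrefl ≡.refl (ℕ.<-≤-trans d<p^m+1
            (ℕ.≤-trans (ℕ.^-monoʳ-≤ p {{prime⇒nonZero p-prime}} m<t) (∣⇒≤ (GCD.gcd∣m isGCD))))
    ^-monoʳ-∣ : ∀ {i j} → i ℕ.≤ j → p ℕ.^ i ∣ p ℕ.^ j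
    ^-monoʳ-∣ {i} {j} i≤j with ℕ.m≤n⇒∃[o]m+o≡n i≤j
    ... | o , ≡.refl = divides (p ℕ.^ o) (≡.trans (ℕ.^-distribˡ-+-* p i o) (ℕ.*-comm (p ℕ.^ i) (p ℕ.^ o)))

module PowerProperties {c ℓ} (G : Group c ℓ) where

  open Group G
  open Powers G
  open Mult monoid using (×-homo-+)
  open GroupProperties G using (identityʳ-unique)

  ε^n≈ε : ∀ n → ε ^ n ≈ ε
  ε^n≈ε ℕ.zero    = refl
  ε^n≈ε (ℕ.suc n) = trans (identityˡ _) (ε^n≈ε n)

  agreement⇒period : ∀ {x b i j} → i ≢ j → i ℕ.< b → j ℕ.< b → x ^ i ≈ x ^ j →
                     ∃ λ d → 0 ℕ.< d × d ℕ.< b × x ^ d ≈ ε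
  agreement⇒period {x} {b} {i} {j} i≢j i<b j<b xⁱ≈xʲ =
    [ (λ i≤j → ordered (ℕ.≤∧≢⇒< i≤j i≢j) j<b xⁱ≈xʲ)
    , (λ j≤i → ordered (ℕ.≤∧≢⇒< j≤i (i≢j ∘ ≡.sym)) i<b (sym xⁱ≈xʲ)) ]′ (ℕ.≤-total i j)
    where
    ordered : ∀ {i j} → i ℕ.< j → j ℕ.< b → x ^ i ≈ x ^ j → ∃ λ d → 0 ℕ.< d × d ℕ.< b × x ^ d ≈ ε
    ordered {i} {j} i<j j<b xⁱ≈xʲ =
      j ℕ.∸ i , ℕ.m<n⇒0<n∸m i<j , ℕ.≤-<-trans (ℕ.m∸n≤m j i) j<b ,
      identityʳ-unique (x ^ i) _ (trans (sym (×-homo-+ x i (j ℕ.∸ i)))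
        (trans (reflexive (≡.cong (x ^_) (ℕ.m+[n∸m]≡n (ℕ.<⇒≤ i<j)))) (sym xⁱ≈xʲ)))

-- Linear algebra and characters over a field with decidable equality

module LinearAlgebra {c ℓ} (E : Field c ℓ) (_≟_ : Decidable (Field._≈_ E)) where

  open Field E hiding (zero)
  open SemiringSum semiring
  open RingProperties ring using (-‿distribˡ-*; -‿distribʳ-*)
  open CommutativeSemigroupProperties *-commutativeSemigroup using (x∙yz≈y∙xz; xy∙z≈y∙xz; xy∙z≈x∙zy)
  open GroupProperties +-group using (x∙y⁻¹≈ε⇒x≈y; inverseʳ-unique; ⁻¹-involutive)
  open ≈-Reasoning setoid

  -x*-y≈xy : ∀ x y → (- x) * (- y) ≈ x * y
  -x*-y≈xy x y = begin
    (- x) * (- y)  ≈⟨ -‿distribˡ-* x (- y) ⟨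
    - (x * - y)    ≈⟨ -‿cong (-‿distribʳ-* x y) ⟨
    - (- (x * y))  ≈⟨ ⁻¹-involutive (x * y) ⟩
    x * y          ∎

  regroup : ∀ a r s t → a * - (r * s) + t ≈ t + (- (a * r)) * s
  regroup a r s t = begin
    a * - (r * s) + t      ≈⟨ +-comm _ t ⟩
    t + a * - (r * s)      ≈⟨ +-congˡ (-‿distribʳ-* a (r * s)) ⟨
    t + - (a * (r * s))    ≈⟨ +-congˡ (-‿cong (*-assoc a r s)) ⟨
    t + - ((a * r) * s)    ≈⟨ +-congˡ (-‿distribˡ-* (a * r) s) ⟩
    t + (- (a * r)) * s    ∎

  factorʳ : ∀ a b d e → a * e + (- b) * (d * e) ≈ (a - b * d) * e
  factorʳ a b d e = begin
    a * e + (- b) * (d * e)    ≈⟨ +-congˡ (*-assoc (- b) d e) ⟨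
    a * e + ((- b) * d) * e    ≈⟨ +-congˡ (*-congʳ (-‿distribˡ-* b d)) ⟨
    a * e + (- (b * d)) * e    ≈⟨ distribʳ e a (- (b * d)) ⟨
    (a - b * d) * e            ∎

  factorᵐ : ∀ a u v w → a * (u * v) + (- w) * (a * v) ≈ a * (u - w) * v
  factorᵐ a u v w = begin
    a * (u * v) + (- w) * (a * v)  ≈⟨ +-cong (sym (*-assoc a u v)) (x∙yz≈y∙xz (- w) a v) ⟩
    (a * u) * v + a * ((- w) * v)  ≈⟨ +-congˡ (*-assoc a (- w) v) ⟨
    (a * u) * v + (a * (- w)) * v  ≈⟨ distribʳ v (a * u) (a * (- w)) ⟨
    (a * u + a * (- w)) * v        ≈⟨ *-congʳ (distribˡ a u (- w)) ⟨
    a * (u - w) * v                ∎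

  no-zero-divisors : ∀ {x y} → ¬ x ≈ 0# → x * y ≈ 0# → y ≈ 0#
  no-zero-divisors {x} {y} x≉0 xy≈0 with invertible x x≉0
  ... | x⁻¹ , xx⁻¹≈1 = begin
    y              ≈⟨ *-identityˡ y ⟨
    1# * y         ≈⟨ *-congʳ xx⁻¹≈1 ⟨
    (x * x⁻¹) * y  ≈⟨ xy∙z≈y∙xz x x⁻¹ y ⟩
    x⁻¹ * (x * y)  ≈⟨ *-congˡ xy≈0 ⟩
    x⁻¹ * 0#       ≈⟨ zeroʳ x⁻¹ ⟩
    0#             ∎

  sum-zero : ∀ {n} {f : Fin n → Carrier} → (∀ i → f i ≈ 0#) → sum f ≈ 0#
  sum-zero {n} f≈0 = trans (sum-cong-≋ f≈0) (sum-replicate-zero n)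

  sum-exchange : ∀ {m n} (w : Fin m → Carrier) (a : Fin n → Carrier) (A : Fin m → Fin n → Carrier) →
                 sum (λ i → w i * sum (λ j → a j * A i j)) ≈ sum (λ j → a j * sum (λ i → w i * A i j))
  sum-exchange w a A = begin
    sum (λ i → w i * sum (λ j → a j * A i j))
      ≈⟨ sum-cong-≋ (λ i → *-distribˡ-sum (w i) (λ j → a j * A i j)) ⟩
    sum (λ i → sum (λ j → w i * (a j * A i j)))
      ≈⟨ ∑-comm (λ i j → w i * (a j * A i j)) ⟩
    sum (λ j → sum (λ i → w i * (a j * A i j)))
      ≈⟨ sum-cong-≋ (λ j → sum-cong-≋ (λ i → x∙yz≈y∙xz (w i) (a j) (A i j))) ⟩
    sum (λ j → sum (λ i → a j * (w i * A i j)))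
      ≈⟨ sum-cong-≋ (λ j → *-distribˡ-sum (a j) (λ i → w i * A i j)) ⟨
    sum (λ j → a j * sum (λ i → w i * A i j)) ∎

  -- Gaussian elimination on the first column: deciding equality with zero either finds a pivot or
  -- shows that the first unit vector is a solution.
  homogeneous-system : ∀ {m n} → m ℕ.< n → (A : Fin m → Fin n → Carrier) →
    ∃ λ (x : Fin n → Carrier) → (∃ λ j → ¬ x j ≈ 0#) × (∀ i → sum (λ j → A i j * x j) ≈ 0#)
  homogeneous-system {m} {ℕ.suc n} m<n A with Fin.any? (λ i → ¬? (A i zero ≟ 0#))
  ... | no ¬pivot = 1# ∷ (λ _ → 0#) , (zero , 1≉0) , λ i → begin
    A i zero * 1# + sum (λ j → A i (suc j) * 0#)
      ≈⟨ +-cong (*-congʳ (decidable-stable (A i zero ≟ 0#) (λ ≉0 → ¬pivot (i , ≉0))))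
                (sum-zero {n} (λ j → zeroʳ (A i (suc j)))) ⟩
    0# * 1# + 0#  ≈⟨ trans (+-identityʳ _) (zeroˡ 1#) ⟩
    0#            ∎
  homogeneous-system {ℕ.suc m} {ℕ.suc n} (s<s m<n) A | yes (i₀ , pivot≉0) =
    x , (suc (proj₁ y≉0) , proj₂ y≉0) , solves
    where
    pivot = A i₀ zero
    r     = proj₁ (invertible pivot pivot≉0)

    reduced : Fin (ℕ.suc m) → Fin n → Carrier
    reduced i j = A i (suc j) - A i zero * r * A i₀ (suc j)

    recursive = homogeneous-system m<n (reduced ∘ punchIn i₀)
    y         = proj₁ recursive
    y≉0       = proj₁ (proj₂ recursive)

    x : Fin (ℕ.suc n) → Carrier
    -- The head is forced by equation i₀; substituting it turns every equation into one in y alone,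
    -- and equation i₀ itself into a sum of zeros.
    x = - (r * sum (λ j → A i₀ (suc j) * y j)) ∷ y

    reduction : ∀ i → sum (λ j → A i j * x j) ≈ sum (λ j → reduced i j * y j)
    reduction i = begin
      A i zero * - (r * S₀) + S
        ≈⟨ regroup (A i zero) r S₀ S ⟩
      S + (- (A i zero * r)) * S₀
        ≈⟨ +-congˡ (*-distribˡ-sum (- (A i zero * r)) (λ j → A i₀ (suc j) * y j)) ⟩
      S + sum (λ j → (- (A i zero * r)) * (A i₀ (suc j) * y j))
        ≈⟨ ∑-distrib-+ (λ j → A i (suc j) * y j) (λ j → (- (A i zero * r)) * (A i₀ (suc j) * y j)) ⟨
      sum (λ j → A i (suc j) * y j + (- (A i zero * r)) * (A i₀ (suc j) * y j))
        ≈⟨ sum-cong-≋ (λ j → factorʳ (A i (suc j)) (A i zero * r) (A i₀ (suc j)) (y j)) ⟩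
      sum (λ j → reduced i j * y j) ∎
      where
      S  = sum (λ j → A i (suc j) * y j)
      S₀ = sum (λ j → A i₀ (suc j) * y j)

    solves : ∀ i → sum (λ j → A i j * x j) ≈ 0#
    solves i with i₀ Fin.≟ i
    ... | no  i₀≢i   = trans (reduction i)
      (≡.subst (λ i → sum (λ j → reduced i j * y j) ≈ 0#) (Fin.punchIn-punchOut i₀≢i)
        (proj₂ (proj₂ recursive) _))
    ... | yes ≡.refl = trans (reduction i) (sum-zero (λ j → trans (*-congʳ (vanish j)) (zeroˡ _)))
      where
      vanish : ∀ j → reduced i₀ j ≈ 0#
      vanish j = begin
        A i₀ (suc j) - pivot * r * A i₀ (suc j)
          ≈⟨ +-congˡ (-‿cong (trans (*-congʳ (proj₂ (invertible pivot pivot≉0))) (*-identityˡ _))) ⟩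
        A i₀ (suc j) - A i₀ (suc j)
          ≈⟨ -‿inverseʳ _ ⟩
        0# ∎

  module Over {s} (F : NumberFields.Subfield E s) where
    open NumberFields.Subfield F

    Independent : ∀ {r} → (Fin r → Carrier) → Set (c ⊔ ℓ ⊔ s)
    Independent {r} u = ∀ (a : Fin r → Carrier) → (∀ i → member (a i)) →
                        sum (λ i → a i * u i) ≈ 0# → ∀ i → a i ≈ 0#

    InSpan : ∀ {r} → (Fin r → Carrier) → Carrier → Set (c ⊔ ℓ ⊔ s)
    InSpan {r} u x = ∃ λ (a : Fin r → Carrier) → (∀ i → member (a i)) × x ≈ sum (λ i → a i * u i)

    -- Were `f zero` zero, the relation would lie among the independent u and all of f would vanish;
    -- so one can divide by `f zero` and solve for x.
    dependent⇒inSpan : ∀ {r x} {u : Fin r → Carrier} → Independent u → (f : Fin (ℕ.suc r) → Carrier) →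
                       (∀ i → member (f i)) → (∃ λ i → ¬ f i ≈ 0#) →
                       sum (λ i → f i * (x ∷ u) i) ≈ 0# → InSpan u x
    dependent⇒inSpan {r} {x} {u} independent f f∈ (i₀ , f≉0) relation =
      a , (λ i → *-closed (-‿closed (inv-closed (f∈ zero) f₀f⁻¹≈1)) (f∈ (suc i))) , (begin
        x                          ≈⟨ *-identityˡ x ⟨
        1# * x                     ≈⟨ *-congʳ (trans (*-comm f⁻¹ _) f₀f⁻¹≈1) ⟨
        (f⁻¹ * f zero) * x         ≈⟨ *-assoc f⁻¹ (f zero) x ⟩
        f⁻¹ * (f zero * x)         ≈⟨ -x*-y≈xy f⁻¹ (f zero * x) ⟨
        (- f⁻¹) * - (f zero * x)   ≈⟨ *-congˡ (inverseʳ-unique (f zero * x) S relation) ⟨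
        (- f⁻¹) * S                ≈⟨ *-distribˡ-sum (- f⁻¹) (λ i → f (suc i) * u i) ⟩
        sum (λ i → (- f⁻¹) * (f (suc i) * u i))  ≈⟨ sum-cong-≋ (λ i → *-assoc (- f⁻¹) (f (suc i)) (u i)) ⟨
        sum (λ i → a i * u i)      ∎)
      where
      S = sum (λ i → f (suc i) * u i)
      f₀≉0 : ¬ f zero ≈ 0#
      f₀≉0 f₀≈0 = f≉0 (all-zero i₀)
        where
        all-zero : ∀ i → f i ≈ 0#
        all-zero zero    = f₀≈0
        all-zero (suc i) = independent (f ∘ suc) (f∈ ∘ suc)
          (trans (sym (trans (+-congʳ (trans (*-congʳ f₀≈0) (zeroˡ x))) (+-identityˡ S))) relation) i
      f⁻¹     = proj₁ (invertible (f zero) f₀≉0)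
      f₀f⁻¹≈1 = proj₂ (invertible (f zero) f₀≉0)
      a : Fin r → Carrier
      a i = (- f⁻¹) * f (suc i)

  module Characters {s ℓs} (S : Monoid s ℓs) where
    private module S = Monoid S

    IsCharacter : (S.Carrier → Carrier) → Set (s ⊔ ℓs ⊔ ℓ)
    IsCharacter = IsMonoidHomomorphism S.rawMonoid *-rawMonoid

    -- A separating point is part of the data, because the elimination in `dedekind` evaluates at
    -- it.
    Distinct : ∀ {m} → (Fin m → S.Carrier → Carrier) → Set (s ⊔ ℓ)
    Distinct χ = ∀ i j → i ≢ j → ∃ λ x → ¬ χ i x ≈ χ j x

    -- Dedekind's elimination, run so as to produce a point instead of refuting a relation. With y
    -- separating some later character from the first one, the translate of the combination by y,
    -- minus χ₀(y) times the combination, no longer involves χ₀. If the shorter combination is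
    -- nonzero at x, the original one is nonzero at x or at y ∙ x.
    dedekind : ∀ {m} (χ : Fin m → S.Carrier → Carrier) → (∀ i → IsCharacter (χ i)) →
               Distinct χ → (a : Fin m → Carrier) → ∀ i → ¬ a i ≈ 0# →
               ∃ λ x → ¬ sum (λ i → a i * χ i x) ≈ 0#
    dedekind {ℕ.suc m} χ isCharacter distinct a i aᵢ≉0 with Fin.any? (λ j → ¬? (a (suc j) ≟ 0#))
    ... | no ¬aⱼ≉0 = S.ε , λ ∑≈0 → a₀≉0 i aᵢ≉0 (begin
      a zero                            ≈⟨ *-identityʳ _ ⟨
      a zero * 1#                       ≈⟨ *-congˡ (ε-homo (isCharacter zero)) ⟨
      a zero * χ zero S.ε               ≈⟨ +-identityʳ _ ⟨
      a zero * χ zero S.ε + 0#          ≈⟨ +-congˡ (sum-zero (λ j → trans (*-congʳ (aⱼ≈0 j)) (zeroˡ _))) ⟨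
      sum (λ i → a i * χ i S.ε)         ≈⟨ ∑≈0 ⟩
      0#                                ∎)
      where
      open IsMonoidHomomorphism
      aⱼ≈0 : ∀ j → a (suc j) ≈ 0#
      aⱼ≈0 j = decidable-stable (a (suc j) ≟ 0#) (λ ≉0 → ¬aⱼ≉0 (j , ≉0))
      a₀≉0 : ∀ i → ¬ a i ≈ 0# → ¬ a zero ≈ 0#
      a₀≉0 zero    ≉0 = ≉0
      a₀≉0 (suc j) ≉0 = contradiction (aⱼ≈0 j) ≉0
    ... | yes (j , aⱼ≉0) = witness
      where
      open IsMonoidHomomorphism
      y = proj₁ (distinct (suc j) zero λ ())

      b : Fin m → Carrier
      b k = a (suc k) * (χ (suc k) y - χ zero y)

      bⱼ≉0 : ¬ b j ≈ 0#
      bⱼ≉0 bⱼ≈0 = proj₂ (distinct (suc j) zero λ ()) (x∙y⁻¹≈ε⇒x≈y _ _ (no-zero-divisors aⱼ≉0 bⱼ≈0))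

      recursive = dedekind (χ ∘ suc) (isCharacter ∘ suc)
        (λ i j i≢j → distinct (suc i) (suc j) (i≢j ∘ Fin.suc-injective)) b j bⱼ≉0
      x = proj₁ recursive

      ∑χ : S.Carrier → Carrier
      ∑χ z = sum (λ i → a i * χ i z)

      difference : ∑χ (y S.∙ x) - χ zero y * ∑χ x ≈ sum (λ k → b k * χ (suc k) x)
      difference = begin
        ∑χ (y S.∙ x) - χ zero y * ∑χ x
          ≈⟨ +-congˡ (trans (-‿distribˡ-* _ _) (*-distribˡ-sum (- χ zero y) (λ i → a i * χ i x))) ⟩
        ∑χ (y S.∙ x) + sum (λ i → (- χ zero y) * (a i * χ i x))
          ≈⟨ ∑-distrib-+ (λ i → a i * χ i (y S.∙ x)) (λ i → (- χ zero y) * (a i * χ i x)) ⟨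
        sum (λ i → a i * χ i (y S.∙ x) + (- χ zero y) * (a i * χ i x))
          ≈⟨ sum-cong-≋ (λ i → trans (+-congʳ (*-congˡ (homo (isCharacter i) y x)))
                                      (factorᵐ (a i) (χ i y) (χ i x) (χ zero y))) ⟩
        a zero * (χ zero y - χ zero y) * χ zero x + sum (λ k → b k * χ (suc k) x)
          ≈⟨ +-congʳ (trans (*-congʳ (trans (*-congˡ (-‿inverseʳ _)) (zeroʳ _))) (zeroˡ _)) ⟩
        0# + sum (λ k → b k * χ (suc k) x)
          ≈⟨ +-identityˡ _ ⟩
        sum (λ k → b k * χ (suc k) x) ∎

      witness : ∃ λ z → ¬ ∑χ z ≈ 0#
      witness with ∑χ x ≟ 0#
      ... | no  ≉0 = x , ≉0
      ... | yes ≈0 = y S.∙ x , λ ∑≈0 → proj₂ recursive (begin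
        sum (λ k → b k * χ (suc k) x)   ≈⟨ difference ⟨
        ∑χ (y S.∙ x) - χ zero y * ∑χ x  ≈⟨ +-cong ∑≈0 (-‿cong (trans (*-congˡ ≈0) (zeroʳ _))) ⟩
        0# - 0#                         ≈⟨ -‿inverseʳ _ ⟩
        0#                              ∎)

    -- One coefficient vector serves all i. This is what a spanning set over a subfield provides
    -- when every `χ i` is linear over that subfield.
    Spans : ∀ {m r} → (Fin m → S.Carrier → Carrier) → (Fin r → S.Carrier) → Set (c ⊔ ℓ ⊔ s)
    Spans {r = r} χ u = ∀ x → ∃ λ (a : Fin r → Carrier) → ∀ i → χ i x ≈ sum (λ j → a j * χ i (u j))

    spans-null : ∀ {m r} {χ : Fin m → S.Carrier → Carrier} {u : Fin r → S.Carrier} → Spans χ u →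
                 (w : Fin m → Carrier) → (∀ j → sum (λ i → w i * χ i (u j)) ≈ 0#) →
                 ∀ x → sum (λ i → w i * χ i x) ≈ 0#
    spans-null {χ = χ} {u} spans w null x = begin
      sum (λ i → w i * χ i x)
        ≈⟨ sum-cong-≋ (λ i → *-congˡ (χx≈ i)) ⟩
      sum (λ i → w i * sum (λ j → a j * χ i (u j)))
        ≈⟨ sum-exchange w a (λ i j → χ i (u j)) ⟩
      sum (λ j → a j * sum (λ i → w i * χ i (u j)))
        ≈⟨ sum-zero (λ j → trans (*-congˡ (null j)) (zeroʳ _)) ⟩
      0# ∎
      where
      a   = proj₁ (spans x)
      χx≈ = proj₂ (spans x)

    -- Since r < m, some nontrivial combination of the characters vanishes on all u k, hence
    -- everywhere by `Spans`; for distinct characters this contradicts `dedekind`. Comparing two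
    -- characters on the finitely many u k decides whether they agree, so the coinciding pair is
    -- found by search.
    coincidence : ∀ {m r} (χ : Fin m → S.Carrier → Carrier) → (∀ i → IsCharacter (χ i)) →
                  (u : Fin r → S.Carrier) → Spans χ u → r ℕ.< m →
                  ∃₂ λ i j → i ≢ j × (∀ x → χ i x ≈ χ j x)
    coincidence χ isCharacter u spans r<m
      with Fin.any? (λ i → Fin.any? (λ j → ¬? (i Fin.≟ j) ×-dec Fin.all? (λ k → χ i (u k) ≟ χ j (u k))))
    ... | yes (i , j , i≢j , agree) = i , j , i≢j , λ x →
      let a , χx≈ = spans x in trans (χx≈ i) (trans (sum-cong-≋ (λ k → *-congˡ (agree k))) (sym (χx≈ j)))
    ... | no ¬agree =
      contradiction (spans-null spans w (λ j → trans (sum-cong-≋ (λ i → *-comm (w i) _)) (null j)) x) ∑≉0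
      where
      distinct : Distinct χ
      distinct i j i≢j =
        let k , ≉ = Fin.¬∀⟶∃¬ _ _ (λ k → χ i (u k) ≟ χ j (u k)) (λ agree → ¬agree (i , j , i≢j , agree))
        in u k , ≉
      solution = homogeneous-system r<m (λ k i → χ i (u k))
      w        = proj₁ solution
      null     = proj₂ (proj₂ solution)
      nonzero  = proj₁ (proj₂ solution)
      failure = dedekind χ isCharacter distinct w (proj₁ nonzero) (proj₂ nonzero)
      x   = proj₁ failure
      ∑≉0 = proj₂ failure

    -- An r-element spanning family carrying a relation would leave r − 1 spanning vectors.
    independence : ∀ {m r} (χ : Fin m → S.Carrier → Carrier) → (∀ i → IsCharacter (χ i)) → Distinct χ →
                   (u : Fin r → S.Carrier) → Spans χ u → r ℕ.≤ m →
                   (b : Fin r → Carrier) → (∀ i → sum (λ k → b k * χ i (u k)) ≈ 0#) → ∀ k → b k ≈ 0#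
    independence {r = ℕ.suc r} χ isCharacter distinct u spans r<m b relation k =
      decidable-stable (b k ≟ 0#) contra
      where
      contra : ¬ ¬ b k ≈ 0#
      contra bₖ≉0 =
        let i , j , i≢j , agree = coincidence χ isCharacter (removeAt u k) spans′ r<m
            x , ≉               = distinct i j i≢j
        in ≉ (agree x)
        where
        b⁻¹ = proj₁ (invertible (b k) bₖ≉0)
        spans′ : Spans χ (removeAt u k)
        spans′ x = a′ , λ i → begin
          χ i x
            ≈⟨ χx≈ i ⟩
          sum (λ j → a j * χ i (u j))
            ≈⟨ x+-y·0 _ (relation i) ⟨
          sum (λ j → a j * χ i (u j)) + (- (a k * b⁻¹)) * sum (λ j → b j * χ i (u j))
            ≈⟨ +-congˡ (*-distribˡ-sum (- (a k * b⁻¹)) (λ j → b j * χ i (u j))) ⟩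
          sum (λ j → a j * χ i (u j)) + sum (λ j → (- (a k * b⁻¹)) * (b j * χ i (u j)))
            ≈⟨ ∑-distrib-+ (λ j → a j * χ i (u j)) (λ j → (- (a k * b⁻¹)) * (b j * χ i (u j))) ⟨
          sum (λ j → a j * χ i (u j) + (- (a k * b⁻¹)) * (b j * χ i (u j)))
            ≈⟨ sum-cong-≋ (λ j → factorʳ (a j) (a k * b⁻¹) (b j) (χ i (u j))) ⟩
          sum (λ j → (a j - a k * b⁻¹ * b j) * χ i (u j))
            ≈⟨ sum-remove {i = k} (λ j → (a j - a k * b⁻¹ * b j) * χ i (u j)) ⟩
          (a k - a k * b⁻¹ * b k) * χ i (u k) + sum (λ j → a′ j * χ i (u (punchIn k j)))
            ≈⟨ +-congʳ (trans (*-congʳ vanish) (zeroˡ _)) ⟩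
          0# + sum (λ j → a′ j * χ i (u (punchIn k j)))
            ≈⟨ +-identityˡ _ ⟩
          sum (λ j → a′ j * χ i (u (punchIn k j))) ∎
          where
          a   = proj₁ (spans x)
          χx≈ = proj₂ (spans x)
          a′ : Fin r → Carrier
          a′ j = a (punchIn k j) - a k * b⁻¹ * b (punchIn k j)
          x+-y·0 : ∀ {x z} y → z ≈ 0# → x + (- y) * z ≈ x
          x+-y·0 y z≈0 = trans (+-congˡ (trans (*-congˡ z≈0) (zeroʳ _))) (+-identityʳ _)
          vanish : a k - a k * b⁻¹ * b k ≈ 0#
          vanish = trans (+-congˡ (-‿cong (trans (xy∙z≈x∙zy _ _ _)
            (trans (*-congˡ (proj₂ (invertible (b k) bₖ≉0))) (*-identityʳ _))))) (-‿inverseʳ _)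

sum-homo : (M : Monoid c ℓ) (N : Monoid c′ ℓ′) →
           let module M = Monoid M
               module N = Monoid N in
           ∀ {f} → IsMonoidHomomorphism M.rawMonoid N.rawMonoid f →
           ∀ {n} (x : Fin n → M.Carrier) → f (MonoidSum.sum M x) N.≈ MonoidSum.sum N (f ∘ x)
sum-homo M N hom {ℕ.zero}  x = IsMonoidHomomorphism.ε-homo hom
sum-homo M N hom {ℕ.suc n} x =
  N.trans (IsMonoidHomomorphism.homo hom _ _) (N.∙-congˡ (sum-homo M N hom (x ∘ suc)))
  where module N = Monoid N

sum-closed : ∀ {s} {E : Field c ℓ} (F : NumberFields.Subfield E s) → let open NumberFields.Subfield F in
             ∀ {n} {x : Fin n → Field.Carrier E} → (∀ i → member (x i)) →
             member (CMSum.sum (Field.+-commutativeMonoid E) x)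
sum-closed F {ℕ.zero}  x∈ = NumberFields.Subfield.0∈ F
sum-closed F {ℕ.suc n} x∈ = NumberFields.Subfield.+-closed F (x∈ zero) (sum-closed F (x∈ ∘ suc))

-- Decidable equality, bases and embeddings of number fields

module NumberFieldProperties {c ℓ} (Ω : Field c ℓ) (char0 : CharacteristicZero Ω) (s : Level) where

  open NumberFields Ω s
  private module Ω = Field Ω
  open Ω using (_≈_; _*_; 0#; 1#)
  open CMSum Ω.+-commutativeMonoid using (sum; sum-cong-≋; sum-replicate-zero)
  open GroupProperties Ω.+-group using (⁻¹-involutive; ε⁻¹≈ε; x∙y⁻¹≈ε⇒x≈y; x≈y⇒x∙y⁻¹≈ε)
  open Powers Ω.+-group
  open PowerProperties Ω.+-group using (ε^n≈ε)
  open SemiringMult Ω.semiring using (×-assoc-*)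
  open Mult Ω.+-monoid using () renaming (×-congʳ to ^-cong)
  open ≈-Reasoning Ω.setoid

  torsion-free : ∀ n {x} → x ^ ℕ.suc n ≈ 0# → x ≈ 0#
  torsion-free n {x} nx≈0 with Ω.invertible (1# ^ ℕ.suc n) (char0 n)
  ... | y , ny≈1 = begin
    x                            ≈⟨ Ω.*-identityˡ x ⟨
    1# * x                       ≈⟨ Ω.*-congʳ (Ω.trans (Ω.*-comm y _) ny≈1) ⟨
    (y * 1# ^ ℕ.suc n) * x       ≈⟨ Ω.*-assoc y _ x ⟩
    y * (1# ^ ℕ.suc n * x)       ≈⟨ Ω.*-congˡ (×-assoc-* (ℕ.suc n) 1# x) ⟩
    y * ((1# * x) ^ ℕ.suc n)     ≈⟨ Ω.*-congˡ (^-cong (ℕ.suc n) (Ω.*-identityˡ x)) ⟩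
    y * (x ^ ℕ.suc n)            ≈⟨ Ω.*-congˡ nx≈0 ⟩
    y * 0#                       ≈⟨ Ω.zeroʳ y ⟩
    0#                           ∎

  -- The numerator decides. If it is zero, x is killed by a positive denominator; if not, x ≈ 0
  -- would make a positive multiple of 1 vanish in characteristic zero.
  rational-zero? : ∀ {x} → IsRational x → Dec (x ≈ 0#)
  rational-zero? {x} (q , dx≈n) with ↥ q
  ... | + 0       = yes (torsion-free (ℚ.denominator-1 q) dx≈n)
  ... | + ℕ.suc n = no λ x≈0 → char0 n (Ω.trans (Ω.sym dx≈n)
                      (Ω.trans (^-cong (↧ₙ q) x≈0) (ε^n≈ε (↧ₙ q))))
  ... | -[1+ n ]  = no λ x≈0 → char0 n (begin
    1# ^ ℕ.suc n              ≈⟨ ⁻¹-involutive _ ⟨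
    Ω.- (Ω.- (1# ^ ℕ.suc n))  ≈⟨ Ω.-‿cong dx≈n ⟨
    Ω.- (x ^ (↧ₙ q))          ≈⟨ Ω.-‿cong (Ω.trans (^-cong (↧ₙ q) x≈0) (ε^n≈ε (↧ₙ q))) ⟩
    Ω.- 0#                    ≈⟨ ε⁻¹≈ε ⟩
    0#                        ∎)

  asField : NumberField → Field _ _
  asField k = record
    { commutativeRing = asRing
    ; 1≉0             = Ω.1≉0
    ; invertible      = λ (x , x∈) x≉0 → let y , xy≈1 = Ω.invertible x x≉0 in
                        (y , inv-closed x∈ xy≈1) , xy≈1
    }
    where open NumberField k

  -- Independence over the rationals reduces the question to the finitely many rational coordinates
  -- of x - y.
  _≟_ : ∀ {k} → Decidable (Field._≈_ (asField k))
  _≟_ {k} x y = map′ (x∙y⁻¹≈ε⇒x≈y _ _) x≈y⇒x∙y⁻¹≈ε (zero? (proj₂ (x E.- y)))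
    where
    module E = Field (asField k)
    open NumberField k
    open Basis basis
    zero? : ∀ {z} → z ∈ member → Dec (z ≈ 0#)
    zero? z∈ with spanning z∈
    ... | a , a∈ℚ , z≈ with Fin.all? (λ i → rational-zero? (a∈ℚ i))
    ... | yes a≈0 = yes (Ω.trans z≈ (Ω.trans
      (sum-cong-≋ (λ i → Ω.trans (Ω.*-congʳ (a≈0 i)) (Ω.zeroˡ (vector i)))) (sum-replicate-zero degree)))
    ... | no  a≉0 = no λ z≈0 → a≉0 (independent a a∈ℚ (Ω.trans (Ω.sym z≈) z≈0))

  -- Equality is decidable in L but not known to be so in Ω, so L takes over the role of the ambient
  -- field and bases are carried into it.
  module Inside (L : NumberField) where

    private module L = Field (asField L)
    open CMSum L.+-commutativeMonoid using () renaming (sum to sumᴸ; sum-cong-≋ to sumᴸ-cong)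
    open LinearAlgebra (asField L) (_≟_ {L})

    -- The members of k, as elements of the ring asRing L instead of Ω.
    infix 4 _∈ᴸ_
    _∈ᴸ_ : L.Carrier → NumberField → Set s
    x ∈ᴸ k = proj₁ x ∈ NumberField.member k

    Basisᴸ : NumberField → NumberField → ℕ → Set _
    Basisᴸ k k′ = NumberFields.Basis (asField L) s (_∈ᴸ k) (_∈ᴸ k′)

    module Basisᴸ {k k′ d} (B : Basisᴸ k k′ d) = NumberFields.Basis B

    proj₁-sum : ∀ {k} {n} (x : Fin n → Field.Carrier (asField k)) →
                proj₁ (CMSum.sum (Field.+-commutativeMonoid (asField k)) x) ≡ sum (proj₁ ∘ x)
    proj₁-sum {n = ℕ.zero}  x = ≡.refl
    proj₁-sum {k} {n = ℕ.suc n} x = ≡.cong (proj₁ (x zero) Ω.+_) (proj₁-sum {k} (x ∘ suc))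

    proj₁-sumᴸ : ∀ {n} (x : Fin n → L.Carrier) → proj₁ (sumᴸ x) ≈ sum (proj₁ ∘ x)
    proj₁-sumᴸ x = Ω.reflexive (proj₁-sum {L} x)

    toBasisᴸ : ∀ {k k′ d} → k ⊑ L → k′ ⊑ L → HasDegree k k′ d → Basisᴸ k k′ d
    toBasisᴸ {d = d} k⊑L k′⊑L B = record
      { vector      = λ i → vector i , k′⊑L (vector∈ i)
      ; vector∈     = vector∈
      ; spanning    = λ x∈ → let a , a∈ , x≈ = spanning x∈ in
                      (λ i → a i , k⊑L (a∈ i)) , a∈ , Ω.trans x≈ (Ω.sym (proj₁-sumᴸ {d} _))
      ; independent = λ a a∈ ∑≈0 → independent (proj₁ ∘ a) a∈ (Ω.trans (Ω.sym (proj₁-sumᴸ {d} _)) ∑≈0)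
      }
      where open Basis B

    fromBasisᴸ : ∀ {k k′ d} → k ⊑ L → k′ ⊑ L → Basisᴸ k k′ d → HasDegree k k′ d
    fromBasisᴸ {d = d} k⊑L k′⊑L B = record
      { vector      = proj₁ ∘ vector
      ; vector∈     = vector∈
      ; spanning    = λ {x} x∈ → let a , a∈ , x≈ = spanning {x , k′⊑L x∈} x∈ in
                      proj₁ ∘ a , a∈ , Ω.trans x≈ (proj₁-sumᴸ {d} _)
      ; independent = λ a a∈ ∑≈0 → independent (λ i → a i , k⊑L (a∈ i)) a∈ (Ω.trans (proj₁-sumᴸ {d} _) ∑≈0)
      }
      where open NumberFields.Basis B

    -- The values lie in L, since the restriction of an automorphism of L to k′ is not yet known to
    -- map k′ to itself.
    record Embedding (k k′ : NumberField) : Set (c ⊔ ℓ ⊔ s) where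
      private module k′ = Field (asField k′)
      field
        map                : k′.Carrier → L.Carrier
        isRingHomomorphism : IsRingHomomorphism k′.rawRing L.rawRing map
        fixes              : ∀ x → proj₁ x ∈ NumberField.member k → proj₁ (map x) ≈ proj₁ x
      open IsRingHomomorphism isRingHomomorphism public

    module _ {k k′ d} (k⊑k′ : k ⊑ k′) (k⊑L : k ⊑ L) (B : HasDegree k k′ d) where
      private
        module k′ = Field (asField k′)
        open Basis B
        open Characters k′.*-monoid

      basis′ : Fin d → k′.Carrier
      basis′ i = vector i , vector∈ i

      -- The coordinates of x lie in k, which every embedding fixes, so the same coordinates express
      -- all the images of x.
      basis-spans : ∀ {m} (τ : Fin m → Embedding k k′) → Spans (Embedding.map ∘ τ) basis′
      basis-spans τ x = (λ i → a i , k⊑L (a∈ i)) , λ i →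
        let open Embedding (τ i) in
        Ω.trans (⟦⟧-cong {x} {sum′ x′} (Ω.trans x≈ (Ω.reflexive (≡.sym (proj₁-sum {k′} x′)))))
        (Ω.trans (sum-homo k′.+-monoid L.+-monoid +-isMonoidHomomorphism x′)
        (sumᴸ-cong λ j → Ω.trans (*-homo (a′ j) (basis′ j))
                                 (L.*-congʳ {map (basis′ j)} {map (a′ j)} {a j , k⊑L (a∈ j)} (fixes (a′ j) (a∈ j)))))
        where
        open CMSum k′.+-commutativeMonoid using () renaming (sum to sum′)
        a  = proj₁ (spanning (proj₂ x))
        a∈ = proj₁ (proj₂ (spanning (proj₂ x)))
        x≈ = proj₂ (proj₂ (spanning (proj₂ x)))
        a′ : Fin d → k′.Carrier
        a′ i = a i , k⊑k′ (a∈ i)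
        x′ : Fin d → k′.Carrier
        x′ i = a′ i k′.* basis′ i

-- Traces and fixed fields of a cyclic action

module CyclicAction {c ℓ} (E : Field c ℓ) (_≟_ : Decidable (Field._≈_ E))
                    (θ : ℕ → Field.Carrier E → Field.Carrier E)
                    (isRingHomomorphism : ∀ n → IsRingHomomorphism (Field.rawRing E) (Field.rawRing E) (θ n))
                    (θ-zero : ∀ x → Field._≈_ E (θ 0 x) x)
                    (θ-+ : ∀ i j x → Field._≈_ E (θ (i ℕ.+ j) x) (θ i (θ j x))) where

  open Field E hiding (zero)
  open SemiringSum semiring
  open GroupProperties +-group using (∙-cancelˡ; x∙y⁻¹≈ε⇒x≈y)
  open LinearAlgebra E _≟_
  open Characters *-monoid
  open ≈-Reasoning setoid
  private module Hom n = IsRingHomomorphism (isRingHomomorphism n)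

  θ-cong : ∀ n {x y} → x ≈ y → θ n x ≈ θ n y
  θ-cong n = Hom.⟦⟧-cong n

  θ-sum : ∀ n {r} (x : Fin r → Carrier) → θ n (sum x) ≈ sum (θ n ∘ x)
  θ-sum n = sum-homo +-monoid +-monoid (Hom.+-isMonoidHomomorphism n)

  module _ (x : Carrier) where
    private
      Fixed : ℕ → Set ℓ
      Fixed n = θ n x ≈ x

    open Periods Fixed (θ-zero x)
      (λ i j θⁱx≈x θʲx≈x → trans (θ-+ i j x) (trans (θ-cong i θʲx≈x) θⁱx≈x))
      (λ i j θⁱ⁺ʲx≈x θʲx≈x → trans (sym (trans (θ-+ i j x) (θ-cong i θʲx≈x))) θⁱ⁺ʲx≈x)
      public using () renaming (multiple to fixed-multiple; prime-power-period to fixed-prime-power)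

  θ-comm : ∀ i j x → θ i (θ j x) ≈ θ j (θ i x)
  θ-comm i j x = trans (sym (θ-+ i j x)) (trans (reflexive (≡.cong (λ n → θ n x) (ℕ.+-comm i j))) (θ-+ j i x))

  -- Injectivity turns the agreement into a period of x, the difference of i and j, which is below
  -- p^(n+1); its gcd with the period p^N divides pⁿ.
  agreement⇒fixed : (∀ n {x y} → θ n x ≈ θ n y → x ≈ y) → ∀ {p} → Prime p → ∀ N n {i j x} →
                    i ≢ j → i ℕ.< p ℕ.^ ℕ.suc n → j ℕ.< p ℕ.^ ℕ.suc n → θ i x ≈ θ j x →
                    θ (p ℕ.^ N) x ≈ x → θ (p ℕ.^ n) x ≈ x
  agreement⇒fixed injective {p} p-prime N n {i} {j} {x} i≢j i< j< θⁱx≈θʲx θᴺx≈x =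
    [ (λ i≤j → ordered (ℕ.≤∧≢⇒< i≤j i≢j) j< θⁱx≈θʲx)
    , (λ j≤i → ordered (ℕ.≤∧≢⇒< j≤i (i≢j ∘ ≡.sym)) i< (sym θⁱx≈θʲx)) ]′ (ℕ.≤-total i j)
    where
    ordered : ∀ {i j} → i ℕ.< j → j ℕ.< p ℕ.^ ℕ.suc n → θ i x ≈ θ j x → θ (p ℕ.^ n) x ≈ x
    ordered {i} {j} i<j j< eq with ℕ.m≤n⇒∃[o]m+o≡n (ℕ.<⇒≤ i<j)
    ... | d , ≡.refl = fixed-prime-power x p-prime N n 0<d (ℕ.≤-<-trans (ℕ.m≤n+m d i) j<)
      (injective i (sym (trans eq (θ-+ i d x)))) θᴺx≈x
      where
      0<d : 0 ℕ.< d
      0<d = ℕ.n≢0⇒n>0 λ { ≡.refl → ℕ.<-irrefl (≡.sym (ℕ.+-identityʳ i)) i<j }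

  cyclic-shift : ∀ n (f : ℕ → Carrier) → f 0 + sum {n} (λ l → f (ℕ.suc (toℕ l))) ≈ sum {n} (f ∘ toℕ) + f n
  cyclic-shift ℕ.zero    f = +-comm (f 0) 0#
  cyclic-shift (ℕ.suc n) f = trans (+-congˡ (cyclic-shift n (f ∘ ℕ.suc))) (sym (+-assoc _ _ _))

  module Trace (m : ℕ) (θᵐ≈id : ∀ x → θ m x ≈ x) (0<m : 0 ℕ.< m)
               (distinct : Distinct {m} (λ i → θ (toℕ i))) where

    trace : Carrier → Carrier
    trace y = sum {m} (λ l → θ (toℕ l) y)

    -- θ shifts the orbit sum by one place, and the two ends θ⁰ y and θᵐ y agree.
    trace-fixed : ∀ y → θ 1 (trace y) ≈ trace y
    trace-fixed y = ∙-cancelˡ (θ 0 y) _ _ (begin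
      θ 0 y + θ 1 (trace y)
        ≈⟨ +-congˡ (θ-sum 1 {m} (λ l → θ (toℕ l) y)) ⟩
      θ 0 y + sum {m} (λ l → θ 1 (θ (toℕ l) y))
        ≈⟨ +-congˡ (sum-cong-≋ {m} (λ l → θ-+ 1 (toℕ l) y)) ⟨
      θ 0 y + sum {m} (λ l → θ (ℕ.suc (toℕ l)) y)
        ≈⟨ cyclic-shift m (λ l → θ l y) ⟩
      trace y + θ m y
        ≈⟨ +-comm _ _ ⟩
      θ m y + trace y
        ≈⟨ +-congʳ (trans (θᵐ≈id y) (sym (θ-zero y))) ⟩
      θ 0 y + trace y ∎)

    -- The trace is the combination of the distinct characters θⁱ with all coefficients 1, so
    -- `dedekind` applies.
    trace≉0 : ∃ λ y → ¬ trace y ≈ 0#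
    trace≉0 =
      let y , ∑≉0 = dedekind {m} (λ i → θ (toℕ i)) (λ i → Hom.*-isMonoidHomomorphism (toℕ i)) distinct
                      (λ _ → 1#) (fromℕ< 0<m) 1≉0
      in y , λ tr≈0 → ∑≉0 (trans (sum-cong-≋ {m} (λ i → *-identityˡ _)) tr≈0)

    -- Artin's lemma: a relation between the vectors (θⁱ xⱼ)ᵢ, scaled so that one of its
    -- coefficients has nonzero trace, gives a relation between the xⱼ by taking traces.
    artin : ∀ {b r} .{{_ : NonZero b}} → b ℕ.< r → (x : Fin r → Carrier) → (∀ j → θ b (x j) ≈ x j) →
            ∃ λ (f : Fin r → Carrier) → (∀ j → θ 1 (f j) ≈ f j) ×
              (∃ λ j → ¬ f j ≈ 0#) × sum (λ j → f j * x j) ≈ 0#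
    artin {ℕ.suc b} {r} b<r x fix = f , trace-fixed ∘ d , (j₀ , f≉0) , relation
      where
      solution = homogeneous-system b<r (λ i j → (θ (toℕ i)) (x j))
      e    = proj₁ solution
      j₀   = proj₁ (proj₁ (proj₂ solution))
      e≉0  = proj₂ (proj₁ (proj₂ solution))
      null = proj₂ (proj₂ solution)
      e⁻¹  = proj₁ (invertible (e j₀) e≉0)
      y    = proj₁ trace≉0

      d f : Fin r → Carrier
      d j = y * (e⁻¹ * e j)
      f j = trace (d j)

      f≉0 : ¬ f j₀ ≈ 0#
      f≉0 f≈0 = proj₂ trace≉0 (trans
        (sum-cong-≋ {m} (λ l → θ-cong (toℕ l) (begin
          y                ≈⟨ *-identityʳ y ⟨
          y * 1#           ≈⟨ *-congˡ (proj₂ (invertible (e j₀) e≉0)) ⟨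
          y * (e j₀ * e⁻¹) ≈⟨ *-congˡ (*-comm _ _) ⟩
          d j₀             ∎))) f≈0)

      -- The linear system only covers exponents below the period `ℕ.suc b`; reduction modulo it
      -- extends the relation to every n.
      mod-b : ∀ n j → θ n (x j) ≈ θ (n % ℕ.suc b) (x j)
      mod-b n j = begin
        θ n (x j)
          ≡⟨ ≡.cong (λ n → θ n (x j)) (m≡m%n+[m/n]*n n (ℕ.suc b)) ⟩
        θ (n % ℕ.suc b ℕ.+ n / ℕ.suc b ℕ.* ℕ.suc b) (x j)
          ≈⟨ θ-+ (n % ℕ.suc b) _ (x j) ⟩
        θ (n % ℕ.suc b) (θ (n / ℕ.suc b ℕ.* ℕ.suc b) (x j))
          ≈⟨ θ-cong (n % ℕ.suc b) (fixed-multiple (x j) (n / ℕ.suc b) (fix j)) ⟩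
        θ (n % ℕ.suc b) (x j) ∎

      null-e : ∀ n → sum (λ j → e j * θ n (x j)) ≈ 0#
      null-e n = trans (sum-cong-≋ (λ j → trans (*-comm (e j) _) (*-congʳ (begin
          θ n (x j)                                ≈⟨ mod-b n j ⟩
          θ (n % ℕ.suc b) (x j)                    ≡⟨ ≡.cong (λ n → θ n (x j)) (Fin.toℕ-fromℕ< n%b<b) ⟨
          θ (toℕ (fromℕ< n%b<b)) (x j)               ∎))))
        (null (fromℕ< n%b<b))
        where n%b<b = m%n<n n (ℕ.suc b)

      null-d : ∀ n → sum (λ j → d j * θ n (x j)) ≈ 0#
      null-d n = begin
        sum (λ j → d j * θ n (x j))
          ≈⟨ sum-cong-≋ (λ j → trans (*-congʳ (sym (*-assoc y e⁻¹ (e j)))) (*-assoc (y * e⁻¹) (e j) _)) ⟩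
        sum (λ j → (y * e⁻¹) * (e j * θ n (x j)))
          ≈⟨ *-distribˡ-sum (y * e⁻¹) (λ j → e j * θ n (x j)) ⟨
        (y * e⁻¹) * sum (λ j → e j * θ n (x j))
          ≈⟨ *-congˡ (null-e n) ⟩
        (y * e⁻¹) * 0#
          ≈⟨ zeroʳ _ ⟩
        0# ∎

      -- θˡ turns Σ dⱼ θ^(bl) xⱼ = 0 into Σ θˡdⱼ θ^((b+1)l) xⱼ = 0, where b + 1 is a period of the xⱼ.
      conjugate : ∀ l → sum (λ j → θ l (d j) * x j) ≈ 0#
      conjugate l = begin
        sum (λ j → θ l (d j) * x j)
          ≈⟨ sum-cong-≋ (λ j → *-congˡ (begin
               x j                            ≈⟨ fixed-multiple (x j) l (fix j) ⟨
               θ (l ℕ.* ℕ.suc b) (x j)     ≡⟨ ≡.cong (λ n → θ n (x j)) (ℕ.*-comm l (ℕ.suc b)) ⟩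
               θ (l ℕ.+ b ℕ.* l) (x j)     ≈⟨ θ-+ l (b ℕ.* l) (x j) ⟩
               θ l (θ (b ℕ.* l) (x j))  ∎)) ⟩
        sum (λ j → θ l (d j) * θ l (θ (b ℕ.* l) (x j)))
          ≈⟨ sum-cong-≋ (λ j → Hom.*-homo l (d j) _) ⟨
        sum (λ j → θ l (d j * θ (b ℕ.* l) (x j)))
          ≈⟨ θ-sum l (λ j → d j * θ (b ℕ.* l) (x j)) ⟨
        θ l (sum (λ j → d j * θ (b ℕ.* l) (x j)))
          ≈⟨ θ-cong l (null-d (b ℕ.* l)) ⟩
        θ l 0#
          ≈⟨ Hom.0#-homo l ⟩
        0# ∎

      relation : sum (λ j → f j * x j) ≈ 0#
      relation = begin
        sum (λ j → f j * x j)
          ≈⟨ sum-cong-≋ (λ j → *-distribʳ-sum {m} (x j) (λ l → θ (toℕ l) (d j))) ⟩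
        sum (λ j → sum {m} (λ l → θ (toℕ l) (d j) * x j))
          ≈⟨ ∑-comm {r} {m} (λ j l → θ (toℕ l) (d j) * x j) ⟩
        sum {m} (λ l → sum (λ j → θ (toℕ l) (d j) * x j))
          ≈⟨ sum-zero {m} (λ l → conjugate (toℕ l)) ⟩
        0# ∎

    module Fixes {s} (F : NumberFields.Subfield E s)
                 (fixes : ∀ {x} → NumberFields.Subfield.member F x → θ 1 x ≈ x) where

      open NumberFields.Subfield F
      open Over F

      θ-fixes : ∀ n {x} → member x → θ n x ≈ x
      θ-fixes n {x} x∈ = ≡.subst (λ n → θ n x ≈ x) (ℕ.*-identityʳ n) (fixed-multiple x n (fixes x∈))

      θ-combination : ∀ n {r} (a v : Fin r → Carrier) → (∀ i → member (a i)) →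
                      θ n (sum (λ i → a i * v i)) ≈ sum (λ i → a i * θ n (v i))
      θ-combination n a v a∈ = trans (θ-sum n (λ i → a i * v i))
        (sum-cong-≋ (λ i → trans (Hom.*-homo n (a i) (v i)) (*-congʳ (θ-fixes n (a∈ i)))))

      -- With 1 = Σ dₖ vₖ and x = Σ aₖ vₖ, the relations Σ (aₖ − x dₖ) θⁱvₖ = 0 force aₖ = x dₖ for all k.
      fixed⇒member : ∀ {r} (v : Fin r → Carrier) → r ℕ.≤ m → (∀ x → InSpan v x) →
                     ∀ {x} → θ 1 x ≈ x → member x
      fixed⇒member {r} v r≤m span {x} θx≈x = resp aₖdₖ⁻¹≈x (*-closed (a∈ k₀) (inv-closed (d∈ k₀) dd⁻¹≈1))
        where
        a   = proj₁ (span x)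
        a∈  = proj₁ (proj₂ (span x))
        x≈  = proj₂ (proj₂ (span x))
        d   = proj₁ (span 1#)
        d∈  = proj₁ (proj₂ (span 1#))
        1≈  = proj₂ (proj₂ (span 1#))

        spans : Spans (λ (i : Fin m) → θ (toℕ i)) v
        spans y = let b , b∈ , y≈ = span y in
          b , λ i → trans (θ-cong (toℕ i) y≈) (θ-combination (toℕ i) b v b∈)

        θx≈x′ : ∀ n → θ n x ≈ x
        θx≈x′ n = ≡.subst (λ n → θ n x ≈ x) (ℕ.*-identityʳ n) (fixed-multiple x n θx≈x)

        relation : ∀ (i : Fin m) → sum (λ k → (a k - x * d k) * θ (toℕ i) (v k)) ≈ 0#
        relation i = begin
          sum (λ k → (a k - x * d k) * θ (toℕ i) (v k))
            ≈⟨ sum-cong-≋ (λ k → factorʳ (a k) x (d k) (θ (toℕ i) (v k))) ⟨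
          sum (λ k → a k * θ (toℕ i) (v k) + (- x) * (d k * θ (toℕ i) (v k)))
            ≈⟨ ∑-distrib-+ (λ k → a k * θ (toℕ i) (v k)) (λ k → (- x) * (d k * θ (toℕ i) (v k))) ⟩
          sum (λ k → a k * θ (toℕ i) (v k)) + sum (λ k → (- x) * (d k * θ (toℕ i) (v k)))
            ≈⟨ +-congˡ (*-distribˡ-sum (- x) (λ k → d k * θ (toℕ i) (v k))) ⟨
          sum (λ k → a k * θ (toℕ i) (v k)) + (- x) * sum (λ k → d k * θ (toℕ i) (v k))
            ≈⟨ +-cong (trans (θ-cong (toℕ i) x≈) (θ-combination (toℕ i) a v a∈))
                      (*-congˡ (trans (θ-cong (toℕ i) 1≈) (θ-combination (toℕ i) d v d∈))) ⟨
          θ (toℕ i) x + (- x) * θ (toℕ i) 1#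
            ≈⟨ +-cong (θx≈x′ (toℕ i)) (trans (*-congˡ (Hom.1#-homo (toℕ i))) (*-identityʳ _)) ⟩
          x + - x
            ≈⟨ -‿inverseʳ x ⟩
          0# ∎

        a≈xd : ∀ k → a k ≈ x * d k
        a≈xd k = x∙y⁻¹≈ε⇒x≈y _ _ (independence {m} (λ i → θ (toℕ i))
          (λ i → Hom.*-isMonoidHomomorphism (toℕ i)) distinct v spans r≤m (λ k → a k - x * d k) relation k)

        d≉0 : ∃ λ k → ¬ d k ≈ 0#
        d≉0 = Fin.¬∀⟶∃¬ r _ (λ k → d k ≟ 0#) λ d≈0 →
          1≉0 (trans 1≈ (sum-zero (λ k → trans (*-congʳ (d≈0 k)) (zeroˡ (v k)))))

        k₀     = proj₁ d≉0
        d⁻¹    = proj₁ (invertible (d k₀) (proj₂ d≉0))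
        dd⁻¹≈1 = proj₂ (invertible (d k₀) (proj₂ d≉0))

        aₖdₖ⁻¹≈x : a k₀ * d⁻¹ ≈ x
        aₖdₖ⁻¹≈x = begin
          a k₀ * d⁻¹         ≈⟨ *-congʳ (a≈xd k₀) ⟩
          (x * d k₀) * d⁻¹   ≈⟨ *-assoc x (d k₀) d⁻¹ ⟩
          x * (d k₀ * d⁻¹)   ≈⟨ *-congˡ dd⁻¹≈1 ⟩
          x * 1#             ≈⟨ *-identityʳ x ⟩
          x                  ∎

    module FixedField {s} (F : NumberFields.Subfield E s)
                      (fixes : ∀ {x} → NumberFields.Subfield.member F x → θ 1 x ≈ x)
                      (fixed : ∀ {x} → θ 1 x ≈ x → NumberFields.Subfield.member F x) where

      open NumberFields.Subfield F
      open Over F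
      open Fixes F fixes

      -- The r < m vectors found so far impose r conditions on the m coefficients of a combination W
      -- of the θⁱ, so some nontrivial W kills them all. W is linear over F, and a point where it
      -- does not vanish, which `dedekind` supplies, lies outside their span.
      independent-family : ∀ r → r ℕ.≤ m → ∃ λ (u : Fin r → Carrier) → Independent u
      independent-family ℕ.zero    _   = (λ ()) , λ _ _ _ ()
      independent-family (ℕ.suc r) r<m = x ∷ u , independent′
        where
        recursive   = independent-family r (ℕ.<⇒≤ r<m)
        u           = proj₁ recursive
        independent = proj₂ recursive
        solution    = homogeneous-system r<m (λ j i → θ (toℕ i) (u j))
        w           = proj₁ solution
        witness     = dedekind {m} (λ i → θ (toℕ i)) (λ i → Hom.*-isMonoidHomomorphism (toℕ i)) distinct
                        w (proj₁ (proj₁ (proj₂ solution))) (proj₂ (proj₁ (proj₂ solution)))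
        x           = proj₁ witness

        W : Carrier → Carrier
        W z = sum (λ i → w i * θ (toℕ i) z)

        W-u : ∀ j → W (u j) ≈ 0#
        W-u j = trans (sum-cong-≋ (λ i → *-comm (w i) _)) (proj₂ (proj₂ solution) j)

        W-linear : ∀ {n} (a v : Fin n → Carrier) → (∀ j → member (a j)) →
                   W (sum (λ j → a j * v j)) ≈ sum (λ j → a j * W (v j))
        W-linear a v a∈ = trans
          (sum-cong-≋ {m} (λ i → *-congˡ (θ-combination (toℕ i) a v a∈)))
          (sum-exchange w a (λ i j → θ (toℕ i) (v j)))

        W-zero : W 0# ≈ 0#
        W-zero = sum-zero (λ i → trans (*-congˡ (Hom.0#-homo (toℕ i))) (zeroʳ (w i)))

        independent′ : Independent (x ∷ u)
        independent′ a a∈ ∑≈0 = coefficients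
          where
          a₀≈0 : a zero ≈ 0#
          a₀≈0 = no-zero-divisors (proj₂ witness) (begin
            W x * a zero
              ≈⟨ *-comm _ _ ⟩
            a zero * W x
              ≈⟨ +-identityʳ _ ⟨
            a zero * W x + 0#
              ≈⟨ +-congˡ (sum-zero (λ j → trans (*-congˡ (W-u j)) (zeroʳ (a (suc j))))) ⟨
            sum (λ j → a j * W ((x ∷ u) j))
              ≈⟨ W-linear a (x ∷ u) a∈ ⟨
            W (sum (λ j → a j * (x ∷ u) j))
              ≈⟨ sum-cong-≋ {m} (λ i → *-congˡ (θ-cong (toℕ i) ∑≈0)) ⟩
            W 0#
              ≈⟨ W-zero ⟩
            0# ∎)
          coefficients : ∀ i → a i ≈ 0#
          coefficients zero    = a₀≈0
          coefficients (suc i) = independent (a ∘ suc) (a∈ ∘ suc)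
            (trans (sym (trans (+-congʳ (trans (*-congʳ a₀≈0) (zeroˡ x))) (+-identityˡ _))) ∑≈0) i

      -- Together with x there are b + 1 vectors of period b, one more than can be independent; the
      -- traces that `artin` yields as coefficients are fixed by θ and so belong to F.
      inSpan : ∀ {b} .{{_ : NonZero b}} {u : Fin b → Carrier} → Independent u → (∀ i → θ b (u i) ≈ u i) →
               ∀ x → θ b x ≈ x → InSpan u x
      inSpan {b} {u} independent fix-u x fix-x =
        let f , fixed-f , f≉0 , relation = artin (ℕ.n<1+n b) (x ∷ u) λ { zero → fix-x ; (suc i) → fix-u i }
        in dependent⇒inSpan independent f (fixed ∘ fixed-f) f≉0 relation

      independent⇒≤ : ∀ {b r} .{{_ : NonZero b}} {u : Fin r → Carrier} → Independent u →
                      (∀ i → θ b (u i) ≈ u i) → r ℕ.≤ b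
      independent⇒≤ {u = u} independent fix-u = ℕ.≮⇒≥ λ b<r →
        let f , fixed-f , (j , f≉0) , relation = artin b<r u fix-u
        in f≉0 (independent f (fixed ∘ fixed-f) relation j)

-- Galois extensions generated by one automorphism

module CyclicGalois {c ℓ} (Ω : Field c ℓ) (char0 : CharacteristicZero Ω) (s : Level) where

  open NumberFields Ω s
  open NumberFieldProperties Ω char0 s
  private module Ω = Field Ω

  module _ (k k′ : NumberField) where
    private module k = NumberField k

    relativeSubfield : NumberFields.Subfield (asField k′) s
    relativeSubfield = record
      { member     = λ x → proj₁ x ∈ k.member
      ; resp       = k.resp
      ; 0∈         = k.0∈
      ; 1∈         = k.1∈
      ; +-closed   = k.+-closed
      ; *-closed   = k.*-closed
      ; -‿closed   = k.-‿closed
      ; inv-closed = k.inv-closed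
      }

    module AutomorphismPowers (θ : Automorphism k k′) where

      open Powers (Gal k k′) using (_^_)

      θ^ : ℕ → Field.Carrier (asField k′) → Field.Carrier (asField k′)
      θ^ n = Automorphism.map (θ ^ n)

      module Action = CyclicAction (asField k′) (_≟_ {k′}) θ^ (λ n → Automorphism.isRingHomomorphism (θ ^ n))
                        (λ _ → Ω.refl) (Mult.×-homo-+ (Group.monoid (Gal k k′)) θ)

  module _ {k k′ : NumberField} (k⊑k′ : k ⊑ k′) (θ : Automorphism k k′) where

    open Field (asField k′) using (Carrier; _≈_; *-monoid)
    open Inside k′
    open LinearAlgebra (asField k′) (_≟_ {k′})
    open Characters *-monoid
    open AutomorphismPowers k k′ θ
    open Powers (Gal k k′) using (_^_)
    private module Gal = Group (Gal k k′)

    asEmbedding : Automorphism k k′ → Embedding k k′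
    asEmbedding τ = record
      { map                = Automorphism.map τ
      ; isRingHomomorphism = Automorphism.isRingHomomorphism τ
      ; fixes              = Automorphism.fixes τ
      }

    module _ (m : ℕ) (distinct : Distinct {m} (λ i → θ^ (toℕ i))) where

      -- As θᵐ is the identity, every element has period m, so `inSpan` with b = m makes any m
      -- independent vectors span k′.
      fixedField-basis : 0 ℕ.< m → (∀ x → θ^ m x ≈ x) →
                         (∀ {x} → θ^ 1 x ≈ x → proj₁ x ∈ NumberField.member k) → HasDegree k k′ m
      fixedField-basis 0<m θᵐ≈id fixed = fromBasisᴸ {k} {k′} k⊑k′ id record
        { vector      = u
        ; vector∈     = proj₂ ∘ u
        ; spanning    = λ {x} _ → inSpan independent (θᵐ≈id ∘ u) x (θᵐ≈id x)
        ; independent = independent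
        }
        where
        instance _ = >-nonZero 0<m
        open Action.Trace m θᵐ≈id 0<m distinct
        open FixedField (relativeSubfield k k′) (λ {x} x∈ → Automorphism.fixes θ x x∈) (λ {x} → fixed {x})
        u           = proj₁ (independent-family m ℕ.≤-refl)
        independent = proj₂ (independent-family m ℕ.≤-refl)

      θ^-injective : ∀ i j → θ ^ toℕ i Gal.≈ θ ^ toℕ j → i ≡ j
      θ^-injective i j agree with i Fin.≟ j
      ... | yes i≡j = i≡j
      ... | no  i≢j = let x , ≉ = distinct i j i≢j in contradiction (agree x) ≉

      χ : Automorphism k k′ → Fin (ℕ.suc m) → Automorphism k k′
      χ τ zero    = τ
      χ τ (suc i) = θ ^ toℕ i

      -- Among τ and the m powers of θ, two agree because the degree is m; the powers are pairwise
      -- distinct, so τ is one of the two.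
      isPower : HasDegree k k′ m → ∀ τ → ∃ λ i → τ Gal.≈ θ ^ toℕ i
      isPower B τ =
        let i , j , i≢j , agree = coincidence (Automorphism.map ∘ χ τ)
                                    (λ i → Automorphism.*-isMonoidHomomorphism (χ τ i))
                                    (basis′ {k} {k′} k⊑k′ k⊑k′ B)
                                    (basis-spans {k} {k′} k⊑k′ k⊑k′ B (asEmbedding ∘ χ τ)) (ℕ.n<1+n m)
        in choose i j i≢j agree
        where
        choose : ∀ i j → i ≢ j → χ τ i Gal.≈ χ τ j → ∃ λ i → τ Gal.≈ θ ^ toℕ i
        choose zero    zero    i≢j agree = contradiction ≡.refl i≢j
        choose zero    (suc j) i≢j agree = j , agree
        choose (suc i) zero    i≢j agree = i , λ x → Ω.sym (agree x)
        choose (suc i) (suc j) i≢j agree = contradiction (≡.cong suc (θ^-injective i j agree)) i≢j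

    cyclic⇒Galois : ∀ m → Distinct {m} (λ i → θ^ (toℕ i)) → 0 ℕ.< m → (∀ x → θ^ m x ≈ x) →
                    (∀ {x} → θ^ 1 x ≈ x → proj₁ x ∈ NumberField.member k) →
                    ∃ λ (G : Galois k k′) → Finite.card (Galois.finite G) ≡ m
    cyclic⇒Galois m distinct 0<m θᵐ≈id fixed = record
      { k⊑k′      = k⊑k′
      ; [k′:k]    = m
      ; hasDegree = hasDegree
      ; finite    = record
        { card        = m
        ; enumeration = record
          { to        = λ i → θ ^ toℕ i
          ; from      = index
          ; to-cong   = λ { {i} ≡.refl → Gal.refl {θ ^ toℕ i} }
          ; from-cong = λ {τ} {τ′} → index-cong τ τ′
          ; inverse   = (λ { {τ} ≡.refl → Gal.sym {τ} {θ ^ toℕ (index τ)} (index-≈ τ) })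
                      , (λ {i} {τ} τ≈θⁱ → θ^-injective m distinct (index τ) i λ x →
                          Ω.trans (Ω.sym (index-≈ τ x)) (τ≈θⁱ x))
          }
        }
      ; ∣Gal∣     = ≡.refl
      } , ≡.refl
      where
      hasDegree : HasDegree k k′ m
      hasDegree = fixedField-basis m distinct 0<m θᵐ≈id fixed

      index : Automorphism k k′ → Fin m
      index τ = proj₁ (isPower m distinct hasDegree τ)

      index-≈ : ∀ τ → τ Gal.≈ θ ^ toℕ (index τ)
      index-≈ τ = proj₂ (isPower m distinct hasDegree τ)

      index-cong : ∀ τ τ′ → τ Gal.≈ τ′ → index τ ≡ index τ′
      index-cong τ τ′ τ≈τ′ = θ^-injective m distinct (index τ) (index τ′) λ x →
        Ω.trans (Ω.sym (index-≈ τ x)) (Ω.trans (τ≈τ′ x) (index-≈ τ′ x))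

-- The order of a generator of a finite cyclic group

module CyclicGroup {c ℓ} (G : Group c ℓ) (finite : Finite (Group.setoid G)) (σ : Group.Carrier G)
                   (generates : ∀ τ → ∃ λ (z : ℤ) → Group._≈_ G τ (Powers._^ᶻ_ G σ z)) where

  open Group G
  open Powers G
  open PowerProperties G
  open Mult monoid using (×-homo-+; ×-assocˡ)
  open GroupProperties G using (inverseˡ-unique)
  open ≈-Reasoning setoid
  private module F = Finite finite

  module _ (d : ℕ) .{{_ : NonZero d}} (σᵈ≈ε : σ ^ d ≈ ε) where

    power-multiple : ∀ q → σ ^ (q ℕ.* d) ≈ ε
    power-multiple q = trans (sym (×-assocˡ σ q d)) (trans (^-congˡ q σᵈ≈ε) (ε^n≈ε q))

    power-mod : ∀ n → σ ^ n ≈ σ ^ (n % d)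
    power-mod n = begin
      σ ^ n                                ≡⟨ ≡.cong (σ ^_) (m≡m%n+[m/n]*n n d) ⟩
      σ ^ (n % d ℕ.+ n / d ℕ.* d)          ≈⟨ ×-homo-+ σ (n % d) (n / d ℕ.* d) ⟩
      σ ^ (n % d) ∙ σ ^ (n / d ℕ.* d)      ≈⟨ ∙-congˡ (power-multiple (n / d)) ⟩
      σ ^ (n % d) ∙ ε                      ≈⟨ identityʳ _ ⟩
      σ ^ (n % d)                          ∎

    nonnegative-power : ∀ z → ∃ λ n → σ ^ᶻ z ≈ σ ^ n
    nonnegative-power (+ n)    = n , refl
    -- (d - 1)(n + 1) and n + 1 add up to a multiple of the period d.
    nonnegative-power -[1+ n ] = ℕ.pred d ℕ.* ℕ.suc n , sym (inverseˡ-unique _ _ (begin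
      σ ^ (ℕ.pred d ℕ.* ℕ.suc n) ∙ σ ^ ℕ.suc n    ≈⟨ ×-homo-+ σ (ℕ.pred d ℕ.* ℕ.suc n) (ℕ.suc n) ⟨
      σ ^ (ℕ.pred d ℕ.* ℕ.suc n ℕ.+ ℕ.suc n)      ≡⟨ ≡.cong (σ ^_) exponent ⟩
      σ ^ (ℕ.suc n ℕ.* d)                         ≈⟨ power-multiple (ℕ.suc n) ⟩
      ε                                           ∎))
      where
      exponent : ℕ.pred d ℕ.* ℕ.suc n ℕ.+ ℕ.suc n ≡ ℕ.suc n ℕ.* d
      exponent = ≡.trans (ℕ.+-comm _ (ℕ.suc n))
        (≡.trans (≡.cong (ℕ._* ℕ.suc n) (ℕ.suc-pred d)) (ℕ.*-comm d (ℕ.suc n)))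

    residue : ∀ τ → ∃ λ (i : Fin d) → τ ≈ σ ^ toℕ i
    residue τ =
      let z , τ≈ = generates τ
          n , ≈ⁿ = nonnegative-power z
      in fromℕ< (m%n<n n d) , trans τ≈ (trans ≈ⁿ (trans (power-mod n)
           (reflexive (≡.cong (σ ^_) (≡.sym (Fin.toℕ-fromℕ< (m%n<n n d)))))))

    -- Reducing exponents of σ modulo the period d embeds the group into `Fin d`.
    card≤period : F.card ℕ.≤ d
    card≤period = Fin.injective⇒≤ {f = λ i → proj₁ (residue (F.element i))} λ {i} {j} eq →
      ≡.trans (≡.sym (F.index-element i)) (≡.trans (F.index-cong (trans (proj₂ (residue (F.element i)))
        (trans (reflexive (≡.cong (λ r → σ ^ toℕ r) eq)) (sym (proj₂ (residue (F.element j)))))))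
        (F.index-element j))

  -- By pigeonhole on the powers with exponents 0 to `F.card`, there is a positive period at most
  -- `F.card`; `card≤period` forces equality.
  σ^card≈ε : σ ^ F.card ≈ ε
  σ^card≈ε =
    let i , j , i<j , eq = Fin.pigeonhole (ℕ.n<1+n F.card) (λ i → F.index (σ ^ toℕ i))
        σⁱ≈σʲ = trans (sym (F.element-index _)) (trans (reflexive (≡.cong F.element eq)) (F.element-index _))
        d , 0<d , d≤card , σᵈ≈ε = agreement⇒period (ℕ.<⇒≢ i<j) (Fin.toℕ<n i) (Fin.toℕ<n j) σⁱ≈σʲ
        d≡card = ℕ.≤-antisym (ℕ.≤-pred d≤card) (card≤period d {{>-nonZero 0<d}} σᵈ≈ε)
    in ≡.subst (λ n → σ ^ n ≈ ε) d≡card σᵈ≈ε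

  powers-distinct : ∀ {i j} → i ≢ j → i ℕ.< F.card → j ℕ.< F.card → ¬ σ ^ i ≈ σ ^ j
  powers-distinct i≢j i< j< σⁱ≈σʲ =
    let d , 0<d , d<card , σᵈ≈ε = agreement⇒period i≢j i< j< σⁱ≈σʲ
    in ℕ.<⇒≱ d<card (card≤period d {{>-nonZero 0<d}} σᵈ≈ε)

-- The layers of a cyclic p-extension

module CyclicTower {c ℓ} (Ω : Field c ℓ) (char0 : CharacteristicZero Ω) (s : Level)
                   {p : ℕ} (p-prime : Prime p) {K L : NumberFields.NumberField Ω s} {N : ℕ}
                   (L/K : NumberFields.CyclicExtension Ω s K L (p ℕ.^ N)) where

  open NumberFields Ω s
  open NumberFieldProperties Ω char0 s
  open CyclicGalois Ω char0 s
  open Inside L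
  private
    module Ω   = Field Ω
    module K   = NumberField K
    module E   = Field (asField L)
    module L/K = CyclicExtension L/K
    module G   = NumberFields.Galois L/K.galois
    σ = proj₁ L/K.cyclic
    module ⟨σ⟩ = CyclicGroup (Gal K L) G.finite σ (proj₂ L/K.cyclic)
    instance p≢0 = prime⇒nonZero p-prime
    1<p = nonTrivial⇒n>1 p {{prime⇒nonTrivial p-prime}}

  open Powers (Gal K L) using (_^_)
  open AutomorphismPowers K L σ
  open LinearAlgebra (asField L) (_≟_ {L})

  card≡ : Finite.card G.finite ≡ p ℕ.^ N
  card≡ = ≡.trans G.∣Gal∣ L/K.degree

  θᴺ≈id : ∀ x → θ^ (p ℕ.^ N) x E.≈ x
  θᴺ≈id x = ≡.subst (λ n → θ^ n x E.≈ x) card≡ (⟨σ⟩.σ^card≈ε x)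

  θ-+ : ∀ i j x → θ^ (i ℕ.+ j) x E.≈ θ^ i (θ^ j x)
  θ-+ = Mult.×-homo-+ (Group.monoid (Gal K L)) σ

  θ-cong : ∀ n x y → x E.≈ y → θ^ n x E.≈ θ^ n y
  θ-cong n x y = Automorphism.⟦⟧-cong (σ ^ n) {x} {y}

  θ-injective : ∀ n {x y} → θ^ n x E.≈ θ^ n y → x E.≈ y
  θ-injective n {x} {y} = Automorphism.injective (σ ^ n) {x} {y}

  module Subextension (k : NumberField) (K⊑k : K ⊑ k) (k⊑L : k ⊑ L) where
    private
      module k = Field (asField k)

    inclusion : k.Carrier → E.Carrier
    inclusion (x , x∈) = x , k⊑L x∈

    inclusion-isRingHomomorphism : IsRingHomomorphism k.rawRing E.rawRing inclusion
    inclusion-isRingHomomorphism = record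
      { isSemiringHomomorphism = record
        { isNearSemiringHomomorphism = record
          { +-isMonoidHomomorphism = record
            { isMagmaHomomorphism = record
              { isRelHomomorphism = record { cong = id }
              ; homo = λ _ _ → Ω.refl
              }
            ; ε-homo = Ω.refl
            }
          ; *-homo = λ _ _ → Ω.refl
          }
        ; 1#-homo = Ω.refl
        }
      ; -‿homo = λ _ → Ω.refl
      }

    restriction : Automorphism K L → Embedding K k
    restriction τ = record
      { map                = Automorphism.map τ ∘ inclusion
      ; isRingHomomorphism = Compose.isRingHomomorphism {R₃ = E.rawRing} Ω.trans
                               inclusion-isRingHomomorphism (Automorphism.isRingHomomorphism τ)
      ; fixes              = λ x → Automorphism.fixes τ (inclusion x)
      }

    open Characters k.*-monoid

    restrictedPower : ℕ → k.Carrier → E.Carrier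
    restrictedPower n x = θ^ n (inclusion x)

    restrictedPower-isCharacter : ∀ n → IsCharacter (restrictedPower n)
    restrictedPower-isCharacter n = Embedding.*-isMonoidHomomorphism (restriction (σ ^ n))

    module _ {d} (B : HasDegree K k d) where

      restrictions-span : ∀ {m} (τ : Fin m → Automorphism K L) →
                          Spans (λ i → Embedding.map (restriction (τ i))) (basis′ {K} {k} K⊑k G.k⊑k′ B)
      restrictions-span τ = basis-spans {K} {k} K⊑k G.k⊑k′ B (restriction ∘ τ)

      -- Agreement on the basis is decidable and implies agreement everywhere, so from a mere
      -- negation a basis vector on which the two maps differ can be extracted.
      separation : ∀ i j → ¬ (∀ x → restrictedPower i x E.≈ restrictedPower j x) →
                   ∃ λ x → ¬ restrictedPower i x E.≈ restrictedPower j x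
      separation i j differ =
        let l , ≉ = Fin.¬∀⟶∃¬ d _ (λ l → _≟_ {L} (restrictedPower i (v l)) (restrictedPower j (v l))) agree
        in v l , ≉
        where
        v = basis′ {K} {k} K⊑k G.k⊑k′ B
        -- Both powers are put in one family so that `restrictions-span` gives them common
        -- coordinates.
        τ : Fin 2 → Automorphism K L
        τ zero    = σ ^ i
        τ (suc _) = σ ^ j
        open CMSum E.+-commutativeMonoid using () renaming (sum-cong-≋ to ∑-cong)
        agree : ¬ (∀ l → restrictedPower i (v l) E.≈ restrictedPower j (v l))
        agree eq = differ λ x →
          let a , x≈ = restrictions-span τ x in
          Ω.trans (x≈ zero) (Ω.trans
            (∑-cong {d} {λ l → a l E.* restrictedPower i (v l)} {λ l → a l E.* restrictedPower j (v l)}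
                    (λ l → Ω.*-congˡ (eq l)))
            (Ω.sym (x≈ (suc zero))))

  private
    0<pᴺ : 0 ℕ.< p ℕ.^ N
    0<pᴺ = ℕ.m^n>0 p N

  powers-distinct : ∀ (i j : Fin (p ℕ.^ N)) → i ≢ j → ∃ λ x → ¬ θ^ (toℕ i) x E.≈ θ^ (toℕ j) x
  powers-distinct i j i≢j = Subextension.separation L G.k⊑k′ id G.hasDegree (toℕ i) (toℕ j)
    (⟨σ⟩.powers-distinct (i≢j ∘ Fin.toℕ-injective) (bound i) (bound j))
    where
    bound : ∀ (i : Fin (p ℕ.^ N)) → toℕ i ℕ.< Finite.card G.finite
    bound i = ℕ.<-≤-trans (Fin.toℕ<n i) (ℕ.≤-reflexive (≡.sym card≡))

  private
    module Trace = Action.Trace (p ℕ.^ N) θᴺ≈id 0<pᴺ powers-distinct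

    K-fixed : ∀ {x} → proj₁ x ∈ K.member → θ^ 1 x E.≈ x
    K-fixed {x} = Automorphism.fixes σ x

  -- The equality of [L : K] with the number of automorphisms enters here: L has a basis with no
  -- more vectors than there are distinct powers of σ, as `fixed⇒member` requires.
  fixed⇒∈K : ∀ {x} → θ^ 1 x E.≈ x → proj₁ x ∈ K.member
  fixed⇒∈K {x} = Trace.Fixes.fixed⇒member (relativeSubfield K L) (λ {x} → K-fixed {x}) vector
    (ℕ.≤-reflexive L/K.degree) (λ x → spanning {x} (proj₂ x)) {x}
    where open Basisᴸ {K} {L} (toBasisᴸ {K} {L} G.k⊑k′ id G.hasDegree)

  private
    module F = Trace.FixedField (relativeSubfield K L) (λ {x} → K-fixed {x}) (λ {x} → fixed⇒∈K {x})

  module Layer (n : ℕ) {k : NumberField} (I : Intermediate K L (p ℕ.^ n) k) where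
    open Intermediate I public
    open Subextension k K⊑k k⊑L public
    private
      module k = NumberField k
      module B = Basisᴸ {K} {k} (toBasisᴸ {K} {k} G.k⊑k′ k⊑L hasDegree)
      instance pⁿ≢0 = ℕ.m^n≢0 p n

    agreement⇒fixed : ∀ {i j} → i ≢ j → i ℕ.< p ℕ.^ ℕ.suc n → j ℕ.< p ℕ.^ ℕ.suc n → ∀ {x} →
                      θ^ i x E.≈ θ^ j x → θ^ (p ℕ.^ n) x E.≈ x
    agreement⇒fixed i≢j i< j< {x} agree = Action.agreement⇒fixed (λ n {x} {y} → θ-injective n {x} {y})
      p-prime N n {x = x} i≢j i< j< agree (θᴺ≈id x)

    abstract
      -- The degree pⁿ of k forces two of the pⁿ + 1 restrictions with exponents 0 to pⁿ to coincide
      -- on all of k. These exponents are strictly below p^(n+1), which is the bound under which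
      -- `agreement⇒fixed` lowers the period to pⁿ.
      ∈⇒fixed : ∀ {x} → proj₁ x ∈ k.member → θ^ (p ℕ.^ n) x E.≈ x
      ∈⇒fixed {x} x∈ =
        let i , j , i≢j , agree = coincidence (λ (i : Fin (ℕ.suc (p ℕ.^ n))) → restrictedPower (toℕ i))
                                    (λ i → restrictedPower-isCharacter (toℕ i)) _
                                    (restrictions-span hasDegree (λ i → σ ^ toℕ i)) (ℕ.n<1+n _)
        in agreement⇒fixed (i≢j ∘ Fin.toℕ-injective) (bound i) (bound j) {x}
             (Ω.trans (θ-cong (toℕ i) x _ Ω.refl) (Ω.trans (agree (proj₁ x , x∈)) (θ-cong (toℕ j) _ x Ω.refl)))
        where
        open Characters (Field.*-monoid (asField k))
        bound : ∀ (i : Fin (ℕ.suc (p ℕ.^ n))) → toℕ i ℕ.< p ℕ.^ ℕ.suc n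
        bound i = ℕ.≤-<-trans (ℕ.≤-pred (Fin.toℕ<n i)) (ℕ.^-monoʳ-< p 1<p (ℕ.n<1+n n))

      -- A basis of k over K consists of pⁿ independent vectors of period pⁿ, so by `inSpan` it
      -- already spans everything of that period.
      fixed⇒∈ : ∀ {x} → θ^ (p ℕ.^ n) x E.≈ x → proj₁ x ∈ k.member
      fixed⇒∈ {x} fix =
        let a , a∈ , x≈ = F.inSpan B.independent (λ i → ∈⇒fixed {B.vector i} (B.vector∈ i)) x fix
        in k.resp (Ω.sym x≈) (sum-closed (relativeSubfield k L) (λ i → k.*-closed (K⊑k (a∈ i)) (B.vector∈ i)))

  module Step (n : ℕ) {k k′ : NumberField}
              (I : Intermediate K L (p ℕ.^ n) k) (I′ : Intermediate K L (p ℕ.^ ℕ.suc n) k′) where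
    private
      module k  = NumberField k
      module k′ = NumberField k′
      module E′ = Field (asField k′)
      module I  = Layer n I
      module I′ = Layer (ℕ.suc n) I′
      instance pⁿ≢0 = ℕ.m^n≢0 p n
      q = p ℕ.^ n

    -- Both layers are fixed fields, and what σ^q fixes is fixed by σ^(pq).
    k⊑k′ : k ⊑ k′
    k⊑k′ {x} x∈ = I′.fixed⇒∈ {y} (Action.fixed-multiple y p (I.∈⇒fixed {y} x∈))
      where
      y : E.Carrier
      y = x , I.k⊑L x∈

    -- Otherwise the p^(n+1) basis vectors of k′ over K would all be fixed by σ^(pⁿ), while only pⁿ
    -- such vectors can be independent. This makes the powers of `ρ` distinct.
    k′⋢k : ¬ k′ ⊑ k
    k′⋢k k′⊑k = ℕ.<⇒≱ (ℕ.^-monoʳ-< p 1<p (ℕ.n<1+n n))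
      (F.independent⇒≤ B.independent (λ i → I.∈⇒fixed {B.vector i} (k′⊑k (B.vector∈ i))))
      where module B = Basisᴸ {K} {k′} (toBasisᴸ {K} {k′} G.k⊑k′ I′.k⊑L I′.hasDegree)

    abstract
      stable : ∀ j {x} → proj₁ x ∈ k′.member → proj₁ (θ^ j x) ∈ k′.member
      stable j {x} x∈ = I′.fixed⇒∈ {θ^ j x}
        (Ω.trans (Action.θ-comm (p ℕ.^ ℕ.suc n) j x) (θ-cong j (θ^ (p ℕ.^ ℕ.suc n) x) x (I′.∈⇒fixed {x} x∈)))

    restrict : ℕ → E′.Carrier → E′.Carrier
    restrict j x = proj₁ (θ^ j (I′.inclusion x)) , stable j {I′.inclusion x} (proj₂ x)

    -- q + (p - 1) q = p^(n+1), and σ^(p^(n+1)) is the identity on k′; this gives the surjectivity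
    -- of `ρ`.
    θ^q-inverse : ∀ z → proj₁ z ∈ k′.member → θ^ q (θ^ (ℕ.pred p ℕ.* q) z) E.≈ z
    θ^q-inverse z z∈ = Ω.trans (Ω.sym (θ-+ q (ℕ.pred p ℕ.* q) z))
      (≡.subst (λ m → θ^ m z E.≈ z) (≡.sym (≡.cong (ℕ._* q) (ℕ.suc-pred p))) (I′.∈⇒fixed {z} z∈))

    restrict-inverse : ∀ x → restrict q (restrict (ℕ.pred p ℕ.* q) x) E′.≈ x
    restrict-inverse x = Ω.trans
      (θ-cong q (I′.inclusion (restrict (ℕ.pred p ℕ.* q) x)) (θ^ (ℕ.pred p ℕ.* q) (I′.inclusion x)) Ω.refl)
      (θ^q-inverse (I′.inclusion x) (proj₂ x))

    ρ : Automorphism k k′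
    ρ = record
      { map               = restrict q
      ; isRingIsomorphism = record
        { isRingMonomorphism = record
          { isRingHomomorphism = record
            { isSemiringHomomorphism = record
              { isNearSemiringHomomorphism = record
                { +-isMonoidHomomorphism = record
                  { isMagmaHomomorphism = record
                    { isRelHomomorphism = record { cong = λ {x} {y} → ψ.⟦⟧-cong {x} {y} }
                    ; homo = ψ.+-homo
                    }
                  ; ε-homo = ψ.0#-homo
                  }
                ; *-homo = ψ.*-homo
                }
              ; 1#-homo = ψ.1#-homo
              }
            ; -‿homo = ψ.-‿homo
            }
          ; injective = λ {x} {y} → θ-injective q {I′.inclusion x} {I′.inclusion y}
          }
        ; surjective = λ y → restrict (ℕ.pred p ℕ.* q) y , λ {z} z≈ →
            Ω.trans (ψ.⟦⟧-cong {z} {restrict (ℕ.pred p ℕ.* q) y} z≈) (restrict-inverse y)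
        }
      ; fixes = λ x → I.∈⇒fixed {I′.inclusion x}
      }
      where module ψ = Embedding (I′.restriction (σ ^ q))

    open AutomorphismPowers k k′ ρ using () renaming (θ^ to ρ^)

    ρ^-restrict : ∀ i x → ρ^ i x E′.≈ restrict (i ℕ.* q) x
    ρ^-restrict ℕ.zero    x = Ω.refl
    ρ^-restrict (ℕ.suc i) x = Ω.trans
      (θ-cong q (I′.inclusion (ρ^ i x)) (θ^ (i ℕ.* q) (I′.inclusion x)) (ρ^-restrict i x))
      (Ω.sym (θ-+ q (i ℕ.* q) (I′.inclusion x)))

    ρ-fixed⇒∈ : ∀ {x} → ρ^ 1 x E′.≈ x → proj₁ x ∈ k.member
    ρ-fixed⇒∈ {x} fix = I.fixed⇒∈ {I′.inclusion x} fix

    ρ^p≈id : ∀ x → ρ^ p x E′.≈ x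
    ρ^p≈id x = Ω.trans (ρ^-restrict p x) (I′.∈⇒fixed {I′.inclusion x} (proj₂ x))

    -- If two of these powers agreed on k′, the distinct exponents i q and j q, both below p^(n+1),
    -- would give every element of k′ the period q and put k′ inside k.
    ρ-distinct : ∀ (i j : Fin p) → i ≢ j → ∃ λ x → ¬ ρ^ (toℕ i) x E′.≈ ρ^ (toℕ j) x
    ρ-distinct i j i≢j =
      let x , ≉ = I′.separation I′.hasDegree (toℕ i ℕ.* q) (toℕ j ℕ.* q) differ
      in x , λ agree → ≉ (Ω.trans (Ω.sym (ρ^-restrict (toℕ i) x)) (Ω.trans agree (ρ^-restrict (toℕ j) x)))
      where
      bound : ∀ (i : Fin p) → toℕ i ℕ.* q ℕ.< p ℕ.^ ℕ.suc n
      bound i = ℕ.*-monoˡ-< q (Fin.toℕ<n i)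
      differ : ¬ (∀ x → I′.restrictedPower (toℕ i ℕ.* q) x E.≈ I′.restrictedPower (toℕ j ℕ.* q) x)
      differ agree = k′⋢k λ {x} x∈ → I.fixed⇒∈ {I′.inclusion (x , x∈)}
        (I.agreement⇒fixed (λ eq → i≢j (Fin.toℕ-injective (ℕ.*-cancelʳ-≡ (toℕ i) (toℕ j) q eq)))
          (bound i) (bound j) {I′.inclusion (x , x∈)} (agree (x , x∈)))

    step-Galois : ∃ λ (H : Galois k k′) → Finite.card (Galois.finite H) ≡ p
    step-Galois = cyclic⇒Galois k⊑k′ ρ p ρ-distinct (>-nonZero⁻¹ p) ρ^p≈id (λ {x} → ρ-fixed⇒∈ {x})

-- The norm element of the group ring

module NormElement {r ℓr g ℓg} (R : CommutativeRing r ℓr) (G : Group g ℓg)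
                   (finite : Finite (Group.setoid G)) where

  private
    module R = CommutativeRing R
    module F = Finite finite
  open GroupRing R G finite
  open CMSum R.+-commutativeMonoid using (sum; sum-cong-≋)
  open CMSum (Ring.+-commutativeMonoid groupRing) using () renaming (sum to sumᴳ)
  open Func using () renaming (to to coeff)

  coeff-sum : ∀ {n} (a : Fin n → Element) x → coeff (sumᴳ a) x R.≈ sum (λ i → coeff (a i) x)
  coeff-sum {ℕ.zero}  a x = R.refl
  coeff-sum {ℕ.suc n} a x = R.+-congˡ (coeff-sum (a ∘ suc) x)

  ν-coeff : ∀ x → coeff ν x R.≈ R.1#
  ν-coeff x = R.trans (coeff-sum (δ ∘ F.element) x) (R.trans
    (sum-cong-≋ (λ i → R.trans (indicator-cong (x F.≟ F.element i) (i Fin.≟ F.index x)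
      (λ x≈ → ≡.trans (≡.sym (F.index-element i)) (F.index-cong (G.sym x≈)))
      (λ { ≡.refl → G.sym (F.element-index x) })) (R.sym (R.*-identityʳ _))))
    (∑-indicator (F.index x) (λ _ → R.1#)))
    where module G = Group G

  -- All coefficients of ν are 1, so each coefficient of the convolution counts the group elements.
  -- The multiple is written as a repeated sum, which the module axioms carry over to a power in the
  -- module.
  ν*ν : ν * ν ≈ sumᴳ {F.card} (λ _ → ν)
  ν*ν x = R.trans
    (sum-cong-≋ {F.card} (λ i → R.trans (R.*-cong (ν-coeff _) (ν-coeff _))
                                        (R.trans (R.*-identityʳ _) (R.sym (ν-coeff x)))))
    (R.sym (coeff-sum {F.card} (λ _ → ν) x))

  norm-norm : ∀ {a ℓa} (A : AbelianGroup a ℓa) → let module A = AbelianGroup A in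
              ∀ {_·_} → IsLeftModule groupRing A._≈_ A._∙_ A.ε A._⁻¹ _·_ →
              ∀ z → (ν · (ν · z)) A.≈ Powers._^_ A.group (ν · z) F.card
  norm-norm A {_·_} isModule z = begin
    ν · (ν · z)                          ≈⟨ M.*ₗ-assoc ν ν z ⟨
    (ν * ν) · z                          ≈⟨ M.*ₗ-cong {ν * ν} {sumᴳ {F.card} (λ _ → ν)} ν*ν A.refl ⟩
    sumᴳ {F.card} (λ _ → ν) · z          ≈⟨ sum-homo (Ring.+-monoid groupRing) A.monoid ·z-homo {F.card} (λ _ → ν) ⟩
    MonoidSum.sum A.monoid {F.card} (λ _ → ν · z)  ≈⟨ MonoidSum.sum-replicate A.monoid F.card ⟩
    (ν · z) ^ F.card                     ∎
    where
    module A = AbelianGroup A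
    module M = IsLeftModule isModule
    open Powers A.group
    open ≈-Reasoning A.setoid
    ·z-homo : IsMonoidHomomorphism (Ring.+-rawMonoid groupRing) A.rawMonoid (_· z)
    ·z-homo = record
      { isMagmaHomomorphism = record
        { isRelHomomorphism = record { cong = λ {r} {r′} r≈r′ → M.*ₗ-cong {r} {r′} r≈r′ A.refl }
        ; homo              = M.*ₗ-distribʳ z
        }
      ; ε-homo              = M.*ₗ-zeroˡ z
      }

-- Norms and transfers between finite abelian groups

power-homo : (A : Group c ℓ) (B : Group c′ ℓ′) →
             let module A = Group A
                 module B = Group B in
             ∀ {f} → IsGroupHomomorphism A.rawGroup B.rawGroup f →
             ∀ n x → f (Powers._^_ A x n) B.≈ Powers._^_ B (f x) n
power-homo A B hom ℕ.zero    x = IsGroupHomomorphism.ε-homo hom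
power-homo A B hom (ℕ.suc n) x =
  B.trans (IsGroupHomomorphism.homo hom x (Powers._^_ A x n)) (B.∙-congˡ (power-homo A B hom n x))
  where module B = Group B

module _ {c ℓ : Level} where
  private module X (A : AbelianGroup c ℓ) = AbelianGroup A

  -- What an extension of degree q leaves once the Galois action is forgotten. The relation is put
  -- on the side of the smaller field, where it is a mere power map and so passes to composites.
  record NormTransfer (A B : AbelianGroup c ℓ) (q : ℕ) : Set (c ⊔ ℓ) where
    field
      norm                    : X.Carrier B → X.Carrier A
      transfer                : X.Carrier A → X.Carrier B
      norm-isHomomorphism     : IsGroupHomomorphism (X.rawGroup B) (X.rawGroup A) norm
      transfer-isHomomorphism : IsGroupHomomorphism (X.rawGroup A) (X.rawGroup B) transfer
      norm-surjective         : Surjective (X._≈_ B) (X._≈_ A) norm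
      transfer-injective      : Injective (X._≈_ A) (X._≈_ B) transfer
      norm-transfer           : ∀ x → X._≈_ A (norm (transfer x)) (Powers._^_ (X.group A) x q)

  identity : ∀ A → NormTransfer A A 1
  identity A = record
    { norm                    = id
    ; transfer                = id
    ; norm-isHomomorphism     = Identity.isGroupHomomorphism rawGroup refl
    ; transfer-isHomomorphism = Identity.isGroupHomomorphism rawGroup refl
    ; norm-surjective         = λ y → y , id
    ; transfer-injective      = id
    ; norm-transfer           = λ x → sym (identityʳ x)
    }
    where open AbelianGroup A

  compose : ∀ {A B C q r} → NormTransfer A B q → NormTransfer B C r → NormTransfer A C (r ℕ.* q)
  compose {A} {B} {C} {q} {r} S T = record
    { norm                    = S.norm ∘ T.norm
    ; transfer                = T.transfer ∘ S.transfer
    ; norm-isHomomorphism     = Compose.isGroupHomomorphism A.trans T.norm-isHomomorphism S.norm-isHomomorphism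
    ; transfer-isHomomorphism = Compose.isGroupHomomorphism C.trans
                                  S.transfer-isHomomorphism T.transfer-isHomomorphism
    ; norm-surjective         = FunctionCompose.surjective C._≈_ B._≈_ A._≈_ T.norm-surjective S.norm-surjective
    ; transfer-injective      = S.transfer-injective ∘ T.transfer-injective
    -- The inner pair returns the r-th power of `S.transfer x`, and `S.norm` commutes with powers,
    -- which leaves (x^q)^r.
    ; norm-transfer           = λ x → A.trans (S.⟦⟧-cong (T.norm-transfer (S.transfer x)))
        (A.trans (power-homo B.group A.group S.norm-isHomomorphism r (S.transfer x))
        (A.trans (Powers.^-congˡ A.group r (S.norm-transfer x)) (Mult.×-assocˡ A.monoid x r q)))
    }
    where
    module A = AbelianGroup A
    module B = AbelianGroup B
    module C = AbelianGroup C
    module T = NormTransfer T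
    module S where
      open NormTransfer S public
      open IsGroupHomomorphism norm-isHomomorphism using (⟦⟧-cong) public

  -- For a section s of the norm, (x , t) ↦ s(x) J(t) is injective on A × A[q], as N(s(x) J(t)) = x tᑫ = x.
  card-norm-transfer : ∀ {A B q} → NormTransfer A B q →
    (finA : Finite (X.setoid A)) (finB : Finite (X.setoid B)) →
    Finite.card finA ℕ.* Finite.card (Powers.torsion-finite (X.group A) finA q) ℕ.≤ Finite.card finB
  card-norm-transfer {A} {B} {q} T finA finB =
    Fin.injective⇒≤ {f = λ i → FB.index (point (remQuot FT.card i))} λ {i} {j} eq →
    let x-eq , t-eq = point-injective _ _ _ _ (B.trans (B.sym (FB.element-index _))
                        (B.trans (B.reflexive (≡.cong FB.element eq)) (FB.element-index _)))
    in ≡.trans (≡.sym (Fin.combine-remQuot {FA.card} FT.card i))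
         (≡.trans (≡.cong₂ combine x-eq t-eq) (Fin.combine-remQuot {FA.card} FT.card j))
    where
    module A  = AbelianGroup A
    module B  = AbelianGroup B
    module FA = Finite finA
    module FB = Finite finB
    module FT = Finite (Powers.torsion-finite A.group finA q)
    open NormTransfer T
    module N = IsGroupHomomorphism norm-isHomomorphism
    open Powers A.group
    open GroupProperties B.group using (∙-cancelˡ)

    section : A.Carrier → B.Carrier
    section x = proj₁ (norm-surjective x)

    torsion : Fin FT.card → A.Carrier
    torsion = proj₁ ∘ FT.element

    point : Fin FA.card × Fin FT.card → B.Carrier
    point (i , j) = section (FA.element i) B.∙ transfer (torsion j)

    norm-point : ∀ i j → norm (point (i , j)) A.≈ FA.element i
    norm-point i j = begin
      norm (section (FA.element i) B.∙ transfer (torsion j))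
        ≈⟨ N.homo _ _ ⟩
      norm (section (FA.element i)) A.∙ norm (transfer (torsion j))
        ≈⟨ A.∙-cong (proj₂ (norm-surjective (FA.element i)) B.refl)
                    (A.trans (norm-transfer (torsion j)) (proj₂ (FT.element j))) ⟩
      FA.element i A.∙ A.ε
        ≈⟨ A.identityʳ _ ⟩
      FA.element i ∎
      where open ≈-Reasoning A.setoid

    point-injective : ∀ i j i′ j′ → point (i , j) B.≈ point (i′ , j′) → i ≡ i′ × j ≡ j′
    point-injective i j i′ j′ eq = i≡i′ , ≡.trans (≡.sym (FT.index-element j))
      (≡.trans (FT.index-cong {FT.element j} {FT.element j′} (transfer-injective (∙-cancelˡ _ _ _ (B.trans eq
        (B.∙-congʳ (B.reflexive (≡.cong (section ∘ FA.element) (≡.sym i≡i′))))))))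
      (FT.index-element j′))
      where
      i≡i′ : i ≡ i′
      i≡i′ = ≡.trans (≡.sym (FA.index-element i)) (≡.trans (FA.index-cong
        (A.trans (A.sym (norm-point i j)) (A.trans (N.⟦⟧-cong eq) (norm-point i′ j′)))) (FA.index-element i′))

-- Torsion in a finite group of exponent p^e

module _ {c ℓ} (G : Group c ℓ) (finite : Finite (Group.setoid G)) {p : ℕ} (p-prime : Prime p) where

  open Group G
  open Powers G
  open PowerProperties G
  private
    module F = Finite finite
    instance p≢0 = prime⇒nonZero p-prime
    1<p = nonTrivial⇒n>1 p {{prime⇒nonTrivial p-prime}}
  open Mult monoid using (×-homo-+; ×-assocˡ)

  -- An element killed by p^(m+1) but not by p^m thus has no positive period below p^(m+1), so its
  -- first p^(m+1) powers are distinct.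
  power-period : ∀ m {d y} → 0 ℕ.< d → d ℕ.< p ℕ.^ ℕ.suc m → y ^ d ≈ ε → y ^ (p ℕ.^ ℕ.suc m) ≈ ε →
                 y ^ (p ℕ.^ m) ≈ ε
  power-period m {y = y} 0<d d< = prime-power-period p-prime (ℕ.suc m) m 0<d d<
    where
    open Periods (λ d → y ^ d ≈ ε) refl
      (λ i j yⁱ≈ε yʲ≈ε → trans (×-homo-+ y i j) (trans (∙-cong yⁱ≈ε yʲ≈ε) (identityˡ ε)))
      (λ i j yⁱ⁺ʲ≈ε yʲ≈ε → trans (sym (trans (×-homo-+ y i j) (trans (∙-congˡ yʲ≈ε) (identityʳ _)))) yⁱ⁺ʲ≈ε)

  -- With e = m + 1 + o, leastness of the exponent means that p^(m + o) fails to kill some x, found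
  -- by search through the finite group; its p^o-th power has order p^(m+1).
  element-of-order : ∀ {e} → IsExponent (p ℕ.^ e) → ∀ {m} → ℕ.suc m ℕ.≤ e →
                     ∃ λ y → y ^ (p ℕ.^ ℕ.suc m) ≈ ε × ¬ y ^ (p ℕ.^ m) ≈ ε
  element-of-order isExponent {m} m<e with ℕ.m≤n⇒∃[o]m+o≡n m<e
  ... | o , ≡.refl =
    x ^ (p ℕ.^ o) , trans (shift (ℕ.suc m)) (annihilates x) , λ eq → proj₂ found (trans (sym (shift m)) eq)
    where
    open IsExponent isExponent
    not-smaller : ¬ (∀ i → F.element i ^ (p ℕ.^ (m ℕ.+ o)) ≈ ε)
    not-smaller kills = ℕ.<⇒≱ (ℕ.^-monoʳ-< p 1<p (ℕ.n<1+n (m ℕ.+ o))) (least (ℕ.m^n>0 p (m ℕ.+ o)) λ z →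
      trans (^-congˡ (p ℕ.^ (m ℕ.+ o)) (sym (F.element-index z))) (kills (F.index z)))
    found = Fin.¬∀⟶∃¬ F.card _ (λ i → (F.element i ^ (p ℕ.^ (m ℕ.+ o))) F.≟ ε) not-smaller
    x = F.element (proj₁ found)
    shift : ∀ i → (x ^ (p ℕ.^ o)) ^ (p ℕ.^ i) ≈ x ^ (p ℕ.^ (i ℕ.+ o))
    shift i = trans (×-assocˡ x (p ℕ.^ i) (p ℕ.^ o)) (reflexive (≡.cong (x ^_) (≡.sym (ℕ.^-distribˡ-+-* p i o))))

  torsion-bound : ∀ {e} → IsExponent (p ℕ.^ e) → ∀ h →
                  p ℕ.^ (e ℕ.⊓ h) ℕ.≤ Finite.card (torsion-finite finite (p ℕ.^ h))
  torsion-bound {e} isExponent h = bound (e ℕ.⊓ h) (ℕ.m⊓n≤m e h) (ℕ.m⊓n≤n e h)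
    where
    module FT = Finite (torsion-finite finite (p ℕ.^ h))

    bound : ∀ m → m ℕ.≤ e → m ℕ.≤ h → p ℕ.^ m ℕ.≤ FT.card
    bound ℕ.zero    _   _   = Fin.injective⇒≤ {f = λ (_ : Fin 1) → FT.index (ε , ε^n≈ε (p ℕ.^ h))}
                                λ { {zero} {zero} _ → ≡.refl }
    bound (ℕ.suc m) m<e m<h = Fin.injective⇒≤ {f = λ i → FT.index (power i)} λ {i} {j} eq →
      decidable-stable (i Fin.≟ j) λ i≢j → distinct (i≢j ∘ Fin.toℕ-injective) (Fin.toℕ<n i) (Fin.toℕ<n j)
        (trans (sym (FT.element-index (power i)))
          (trans (reflexive (≡.cong (proj₁ ∘ FT.element) eq)) (FT.element-index (power j))))
      where
      y     = proj₁ (element-of-order isExponent m<e)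
      yᵖ≈ε  = proj₁ (proj₂ (element-of-order isExponent m<e))
      y≉ε   = proj₂ (proj₂ (element-of-order isExponent m<e))

      yʰ≈ε : y ^ (p ℕ.^ h) ≈ ε
      yʰ≈ε with ℕ.m≤n⇒∃[o]m+o≡n m<h
      ... | o , ≡.refl = trans
        (reflexive (≡.cong (y ^_) (≡.trans (ℕ.^-distribˡ-+-* p (ℕ.suc m) o) (ℕ.*-comm (p ℕ.^ ℕ.suc m) _))))
        (trans (sym (×-assocˡ y (p ℕ.^ o) (p ℕ.^ ℕ.suc m))) (trans (^-congˡ (p ℕ.^ o) yᵖ≈ε) (ε^n≈ε (p ℕ.^ o))))

      power : Fin (p ℕ.^ ℕ.suc m) → ∃ (Torsion (p ℕ.^ h))
      power i = y ^ toℕ i , (begin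
        (y ^ toℕ i) ^ (p ℕ.^ h)    ≈⟨ ×-assocˡ y (p ℕ.^ h) (toℕ i) ⟩
        y ^ (p ℕ.^ h ℕ.* toℕ i)    ≡⟨ ≡.cong (y ^_) (ℕ.*-comm (p ℕ.^ h) (toℕ i)) ⟩
        y ^ (toℕ i ℕ.* p ℕ.^ h)    ≈⟨ ×-assocˡ y (toℕ i) (p ℕ.^ h) ⟨
        (y ^ (p ℕ.^ h)) ^ toℕ i    ≈⟨ ^-congˡ (toℕ i) yʰ≈ε ⟩
        ε ^ toℕ i                  ≈⟨ ε^n≈ε (toℕ i) ⟩
        ε                          ∎)
        where open ≈-Reasoning setoid

      distinct : ∀ {i j} → i ≢ j → i ℕ.< p ℕ.^ ℕ.suc m → j ℕ.< p ℕ.^ ℕ.suc m → ¬ y ^ i ≈ y ^ j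
      distinct i≢j i< j< yⁱ≈yʲ =
        let d , 0<d , d< , yᵈ≈ε = agreement⇒period i≢j i< j< yⁱ≈yʲ
        in y≉ε (power-period m 0<d d< yᵈ≈ε yᵖ≈ε)

-- The family of invariants along the tower

module _ {c ℓ s t x ξ : Level} (Ω : Field c ℓ) {p : ℕ} {𝒦 : Pred (NumberFields.NumberField Ω s) t}
         (family : NumberFields.InvariantFamily Ω s p 𝒦 x ξ) where

  open NumberFields Ω s
  open NumberFields.InvariantFamily family

  -- An element J y with y = N z is ν z, on which ν acts as multiplication by [k′ : k].
  galois-normTransfer : ∀ {k k′} (k∈ : k ∈ 𝒦) (k′∈ : k′ ∈ 𝒦) (G : Galois k k′) →
    NormSurjective k∈ k′∈ (Galois.k⊑k′ G) → TransferInjective k∈ k′∈ (Galois.k⊑k′ G) →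
    NormTransfer (𝒳 k k∈) (𝒳 k′ k′∈) (Finite.card (Galois.finite G))
  galois-normTransfer {k} {k′} k∈ k′∈ G surjective injective = record
    { norm                    = N
    ; transfer                = J
    ; norm-isHomomorphism     = 𝐍-isHomomorphism k∈ k′∈ k⊑k′
    ; transfer-isHomomorphism = 𝐉-isHomomorphism k∈ k′∈ k⊑k′
    ; norm-surjective         = surjective
    ; transfer-injective      = injective
    ; norm-transfer           = λ y → injective (JNJ y)
    }
    where
    open Galois G using (k⊑k′)
    d = Finite.card (Galois.finite G)
    module A = AbelianGroup (𝒳 k k∈)
    module B = AbelianGroup (𝒳 k′ k′∈)
    module M = IsLeftModule (isModule k∈ k′∈ G)
    open Powers B.group
    N = 𝐍 k∈ k′∈ k⊑k′
    J = 𝐉 k∈ k′∈ k⊑k′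
    module J = IsGroupHomomorphism (𝐉-isHomomorphism k∈ k′∈ k⊑k′)

    ν : B.Carrier → B.Carrier
    ν = action k∈ k′∈ G (algebraicNorm p G)

    JNJ : ∀ y → J (N (J y)) B.≈ J (Powers._^_ A.group y d)
    JNJ y = begin
      J (N (J y))                      ≈⟨ 𝐉∘𝐍 k∈ k′∈ G (J y) ⟩
      ν (J y)                          ≈⟨ M.*ₗ-congˡ Jy≈νz ⟩
      ν (ν z)                          ≈⟨ νν z ⟩
      ν z ^ d                          ≈⟨ ^-congˡ d Jy≈νz ⟨
      J y ^ d                          ≈⟨ power-homo A.group B.group (𝐉-isHomomorphism k∈ k′∈ k⊑k′) d y ⟨
      J (Powers._^_ A.group y d)       ∎
      where
      open ≈-Reasoning B.setoid
      z = proj₁ (surjective y)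
      νν : ∀ z → ν (ν z) B.≈ ν z ^ d
      νν = NormElement.norm-norm (PAdic.ring p) (Gal k k′) (Galois.finite G) (𝒳 k′ k′∈) (isModule k∈ k′∈ G)
      Jy≈νz : J y B.≈ ν z
      Jy≈νz = B.trans (J.⟦⟧-cong (A.sym (proj₂ (surjective y) B.refl))) (𝐉∘𝐍 k∈ k′∈ G z)

open import Data.Nat.Base using (zero; suc; _+_; _*_; _^_; _⊓_; _≤_; _<_; _≥_)
open import Data.Nat.Properties using (<⇒≤; +-comm; *-monoʳ-≤)

theorem3p2 : ∀ {c ℓ s t x ξ : Level}
    (Ω : Field c ℓ) (char0 : CharacteristicZero Ω) → let open NumberFields Ω s in
    (p : ℕ) (p-prime : Prime p)
    (𝒦 : Pred NumberField t) (stable : StableUnderSubfields 𝒦)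
    (family : InvariantFamily p 𝒦 x ξ) → let open InvariantFamily family in
    (K L : NumberField) (K∈ : K ∈ 𝒦) (L∈ : L ∈ 𝒦)
    (N : ℕ) (L/K : CyclicExtension K L (p ^ N))
    (k : ℕ → NumberField) (k-sub : ∀ n → n ≤ N → Intermediate K L (p ^ n) (k n)) →
    let k∈ : ∀ n → n ≤ N → k n ∈ 𝒦
        k∈ n n≤N = stable (Intermediate.k⊑L (k-sub n n≤N)) L∈ in
    (∀ n (n<N : n < N) (k⊑ : k n ⊑ k (suc n)) →
       NormSurjective (k∈ n (<⇒≤ n<N)) (k∈ (suc n) n<N) k⊑) →
    (∀ n (n<N : n < N) (k⊑ : k n ⊑ k (suc n)) →
       TransferInjective (k∈ n (<⇒≤ n<N)) (k∈ (suc n) n<N) k⊑) →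
    (e : ℕ → ℕ) →
    (∀ n (n≤N : n ≤ N) → HasExponent (k n) (k∈ n n≤N) (p ^ e n)) →
    ∀ n h (n≤N : n ≤ N) (n+h≤N : n + h ≤ N) →
      #𝒳 (k (n + h)) (k∈ (n + h) n+h≤N)
        ≥ #𝒳 (k n) (k∈ n n≤N) * #𝒳-torsion (k n) (k∈ n n≤N) (p ^ h)
      × #𝒳 (k n) (k∈ n n≤N) * #𝒳-torsion (k n) (k∈ n n≤N) (p ^ h)
        ≥ #𝒳 (k n) (k∈ n n≤N) * p ^ (e n ⊓ h)
theorem3p2 {s = s} Ω char0 p p-prime 𝒦 stable family K L K∈ L∈ N L/K k k-sub surjective injective e exponent
           n h n≤N n+h≤N =
  card-norm-transfer {A = 𝒳ₙ n n≤N} {𝒳ₙ (n + h) n+h≤N} (tower h (n + h) (+-comm n h) n+h≤N)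
    (finite (k n) (k∈ n n≤N)) (finite (k (n + h)) (k∈ (n + h) n+h≤N)) ,
  *-monoʳ-≤ (#𝒳 (k n) (k∈ n n≤N))
    (torsion-bound (AbelianGroup.group (𝒳ₙ n n≤N)) (finite (k n) (k∈ n n≤N)) p-prime {e n} (exponent n n≤N) h)
  where
  open NumberFields Ω s
  open InvariantFamily family
  module T = CyclicTower Ω char0 s p-prime {N = N} L/K

  k∈ : ∀ n → n ≤ N → k n ∈ 𝒦
  k∈ n n≤N = stable (Intermediate.k⊑L (k-sub n n≤N)) L∈

  𝒳ₙ : ∀ n → n ≤ N → AbelianGroup _ _
  𝒳ₙ n n≤N = 𝒳 (k n) (k∈ n n≤N)

  step : ∀ n (n<N : n < N) → NormTransfer (𝒳ₙ n (<⇒≤ n<N)) (𝒳ₙ (suc n) n<N) p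
  step n n<N = ≡.subst (NormTransfer (𝒳ₙ n (<⇒≤ n<N)) (𝒳ₙ (suc n) n<N)) (proj₂ S.step-Galois)
    (galois-normTransfer Ω family (k∈ n (<⇒≤ n<N)) (k∈ (suc n) n<N) (proj₁ S.step-Galois)
      (surjective n n<N S.k⊑k′) (injective n n<N S.k⊑k′))
    where module S = T.Step n (k-sub n (<⇒≤ n<N)) (k-sub (suc n) n<N)

  -- The top index is a variable m with an equation, because the recursion on h computes with h + n
  -- while the statement ends at n + h. Each further step multiplies the exponent to p * p ^ h,
  -- which is p ^ suc h by definition.
  tower : ∀ h m → m ≡ h + n → (m≤N : m ≤ N) → NormTransfer (𝒳ₙ n n≤N) (𝒳ₙ m m≤N) (p ^ h)
  tower zero    _ ≡.refl m≤N = identity (𝒳ₙ n n≤N)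
  tower (suc h) _ ≡.refl m≤N = compose (tower h (h + n) ≡.refl (<⇒≤ m≤N)) (step (h + n) m≤N)
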